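{- For every join-tree $A$ over $T_\infty$, \[\Phi_\theta(A)\ \ge\ \tfrac{1}{30}\,\lambda(\langle A\rangle)+\tfrac{2}{5}\,\Delta_\theta(\langle A\rangle).\]
   Context: $T_\infty$ is the infinite tree whose vertex set is partitioned into levels $V_0,V_1,V_2,\dots$ such that each vertex of $V_j$ has exactly one neighbor in $V_{j+1}$ (its parent), each vertex of $V_j$ with $j\ge1$ has exactly two neighbors in $V_{j-1}$ (its children), there are no other edges, and any two vertices have a common ancestor. $V_0$ is the set of leaves. For $x\in V_k$, $T_x$ is the complete binary tree of height $k$ consisting of $x$ and its descendants. Subgraphs have no isolated vertices. For a finite subgraph $F$, $\lambda(F)$ is the maximum $k$ such that some $x\in V_k$ has $T_x\subseteq F$ ($0$ if none). The weighting $\theta:E(T_\infty)\to\mathbb R$ (induced by the uniform random walk) is $\theta(e)=4/3$ if $e$ contains a vertex of $V_0$ and $\theta(e)=2/3$ otherwise; $\Delta_\theta(F)=|V(F)|-\sum_{e\in E(F)}\theta(e)$ for finite $F$. Join-trees: a join-tree over $T_\infty$ is a finite rooted binary tree (each non-leaf node has two ordered children) whose leaves are labeled by elements of $E(T_\infty)\cup\{\bot\}$; its graph $\langle A\rangle$ is the subgraph whose edges are the edge labels occurring in $A$, $V(A)=V(\langle A\rangle)$, and $\Delta_\theta(A)=\Delta_\theta(\langle A\rangle)$. $[\,]$ is the one-node join-tree labeled $\bot$, $[e]$ the one-node join-tree labeled $e$, $[B,C]$ the join-tree whose root has children $B,C$; one-node join-trees are atomic. $D\preceq A$ if $D=[\,]$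 or $D=A$ or $D\preceq$ some child of $A$; $D\prec A$ if $D\preceq A$, $D\ne A$. For a vertex set $S$, $F\ominus S$ is the union of the components of $F$ vertex-disjoint from $S$, and $A\ominus S$ is the join-tree with the same tree as $A$ where a leaf keeps its label iff it is an edge of $\langle A\rangle\ominus S$ (otherwise relabeled $\bot$); for join-trees, $A\ominus(V(C)\cup V(D))$ etc. $\Phi_\theta$ is the pointwise minimal function from join-trees to $\mathbb R_{\ge0}$ satisfying, for all join-trees $A,B,C,D,E$: ($\dagger$) $\Phi_\theta(A)\ge\Phi_\theta(D)+\Delta_\theta(C\ominus V(D))+\Delta_\theta(A\ominus(V(C)\cup V(D)))$ if $A\in\{[B,C],[C,B]\}$ and $D\preceq B$; ($\ddagger$) $\Phi_\theta(A)\ge\frac12\big(\Phi_\theta(D)+\Phi_\theta(E\ominus V(D))+\Delta_\theta(A)+\Delta_\theta(A\ominus(V(D)\cup V(E)))\big)$ if $D,E\prec A$. Equivalently, $\Phi_\theta(A)=\Delta_\theta(A)$ for atomic $A$, and for non-atomic $A$, $\Phi_\theta(A)$ is the maximum of the right-hand sides of all instances of ($\dagger$) and ($\ddagger$). -}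

module Defs where

open import Data.Bool using (Bool; true; false; _∧_; _∨_; not; if_then_else_)
open import Data.Nat as ℕ using (ℕ; zero; suc; _<ᵇ_; _^_)
open import Data.Nat.DivMod using (_/_)
open import Data.Product using (_×_; _,_; proj₁; proj₂)
open import Data.Maybe using (Maybe; just; nothing)
open import Data.List using (List; []; _∷_; _++_; map; concatMap; foldr; length; filterᵇ; deduplicateᵇ; upTo; applyUpTo)
open import Data.Integer using (+_)
open import Data.Bool.ListAction using (any; all)
open import Data.Rational as ℚ using (ℚ; 0ℚ; ½)

-- The infinite tree T∞.
-- A vertex is a pair (j , n) : level j ∈ ℕ, index n ∈ ℕ.  The parent of
-- (j , n) is (j+1 , ⌊n/2⌋); hence (j+1 , n) has exactly the two children
-- (j , 2n) and (j , 2n+1), and any two vertices have a common ancestor.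
-- V₀ = level 0 is the set of leaves.

Vertex : Set
Vertex = ℕ × ℕ

level : Vertex → ℕ
level = proj₁

parent : Vertex → Vertex
parent (j , n) = (suc j , n / 2)

-- Every edge of T∞ joins a vertex to its parent; we identify the edge with
-- its lower endpoint.
Edge : Set
Edge = ℕ × ℕ

ends : Edge → List Vertex
ends e = e ∷ parent e ∷ []

_==_ : ℕ × ℕ → ℕ × ℕ → Bool
(a , b) == (c , d) = (a ℕ.≡ᵇ c) ∧ (b ℕ.≡ᵇ d)

_∈ᵇ_ : ℕ × ℕ → List (ℕ × ℕ) → Bool
x ∈ᵇ xs = any (_== x) xs

-- Finite subgraphs (without isolated vertices) are given by a finite
-- list of edges (duplicates allowed; the graph is the set of edges).

Graph : Set
Graph = List Edge

edgeSet : Graph → List Edge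
edgeSet F = deduplicateᵇ _==_ F

vertexSet : Graph → List Vertex
vertexSet F = deduplicateᵇ _==_ (concatMap ends F)

θ : Edge → ℚ
θ (zero , _)  = + 4 ℚ./ 3
θ (suc _ , _) = + 2 ℚ./ 3

fromℕ : ℕ → ℚ
fromℕ n = + n ℚ./ 1

sumℚ : List ℚ → ℚ
sumℚ = foldr ℚ._+_ 0ℚ

Δθ : Graph → ℚ
Δθ F = fromℕ (length (vertexSet F)) ℚ.- sumℚ (map θ (edgeSet F))

grow : Graph → List Vertex → List Vertex
grow F S = S ++ concatMap ends (filterᵇ (λ e → any (_∈ᵇ S) (ends e)) F)

reach : ℕ → Graph → List Vertex → List Vertex
reach zero    F S = S
reach (suc k) F S = reach k F (grow F S)

-- vertex set of the component of F containing the edge e (e ∈ F);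
-- length F iterations suffice since each component has ≤ length F edges.
componentOf : Graph → Edge → List Vertex
componentOf F e = reach (length F) F (ends e)

keptᵇ : Graph → List Vertex → Edge → Bool
keptᵇ F S e = all (λ v → not (v ∈ᵇ S)) (componentOf F e)

_⊖G_ : Graph → List Vertex → Graph
F ⊖G S = filterᵇ (keptᵇ F S) F

-- edges of T_x for x = (k , n): lower endpoints (i , m) with i < k and
-- m ∈ [n·2^(k−i), (n+1)·2^(k−i)).
edgesOfT : Vertex → List Edge
edgesOfT (k , n) =
  concatMap (λ i → applyUpTo (λ r → (i , n ℕ.* 2 ^ (k ℕ.∸ i) ℕ.+ r)) (2 ^ (k ℕ.∸ i)))
            (upTo k)

Tsubᵇ : Vertex → Graph → Bool
Tsubᵇ x F = all (_∈ᵇ F) (edgesOfT x)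

maxℕ : List ℕ → ℕ
maxℕ = foldr ℕ._⊔_ 0

-- (for level 0, T_x ⊆ F only contributes the value 0 = the default)
λG : Graph → ℕ
λG F = maxℕ (map level (filterᵇ (λ x → Tsubᵇ x F) (vertexSet F)))

data JoinTree : Set where
  leaf : Maybe Edge → JoinTree
  node : JoinTree → JoinTree → JoinTree

⟦⟧ : JoinTree
⟦⟧ = leaf nothing

⟦_⟧ : Edge → JoinTree
⟦ e ⟧ = leaf (just e)

graph : JoinTree → Graph
graph (leaf nothing)  = []
graph (leaf (just e)) = e ∷ []
graph (node B C)      = graph B ++ graph C

V : JoinTree → List Vertex
V A = vertexSet (graph A)

ΔA : JoinTree → ℚ
ΔA A = Δθ (graph A)

relabel : Graph → List Vertex → JoinTree → JoinTree
relabel F S (leaf nothing)  = leaf nothing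
relabel F S (leaf (just e)) = if keptᵇ F S e then leaf (just e) else leaf nothing
relabel F S (node B C)      = node (relabel F S B) (relabel F S C)

_⊖_ : JoinTree → List Vertex → JoinTree
A ⊖ S = relabel (graph A) S A

eqMaybe : Maybe Edge → Maybe Edge → Bool
eqMaybe nothing  nothing  = true
eqMaybe (just e) (just f) = e == f
eqMaybe _        _        = false

eqJT : JoinTree → JoinTree → Bool
eqJT (leaf a)   (leaf b)   = eqMaybe a b
eqJT (node a b) (node c d) = eqJT a c ∧ eqJT b d
eqJT _          _          = false

⪯list : JoinTree → List JoinTree
⪯list (leaf a)   = ⟦⟧ ∷ leaf a ∷ []
⪯list (node B C) = ⟦⟧ ∷ node B C ∷ (⪯list B ++ ⪯list C)

≺list : JoinTree → List JoinTree
≺list A = filterᵇ (λ D → not (eqJT D A)) (⪯list A)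

maxℚ : List ℚ → ℚ
maxℚ = foldr ℚ._⊔_ 0ℚ

-- size: every recursive call below is on a join-tree of strictly smaller size
size : JoinTree → ℕ
size (leaf nothing)  = 0
size (leaf (just _)) = 1
size (node B C)      = suc (size B ℕ.+ size C)

daggerRHS : (JoinTree → ℚ) → JoinTree → List ℚ
daggerRHS Φ (leaf _)   = []
daggerRHS Φ (node B C) =
  concatMap (λ BC → let X = proj₁ BC ; Y = proj₂ BC in
              map (λ D → Φ D ℚ.+ ΔA (Y ⊖ V D) ℚ.+ ΔA (node B C ⊖ (V Y ++ V D)))
                  (⪯list X))
            ((B , C) ∷ (C , B) ∷ [])

ddaggerRHS : (JoinTree → ℚ) → JoinTree → List ℚ
ddaggerRHS Φ A =
  concatMap (λ D → map (λ E → ½ ℚ.* (Φ D ℚ.+ Φ (E ⊖ V D) ℚ.+ ΔA A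
                                       ℚ.+ ΔA (A ⊖ (V D ++ V E))))
                       (≺list A))
            (≺list A)

-- Φθ as the least function into ℚ≥0 satisfying (†) and (‡):
-- Φθ(A) = max(0, all right-hand sides), computed by recursion on size
-- (fuel = size A suffices, since all recursive calls are on smaller trees).
Φfuel : ℕ → JoinTree → ℚ
Φfuel zero    A = 0ℚ
Φfuel (suc n) A = 0ℚ ℚ.⊔ maxℚ (daggerRHS (Φfuel n) A ++ ddaggerRHS (Φfuel n) A)

Φθ : JoinTree → ℚ
Φθ A = Φfuel (size A) A

{-# OPTIONS --safe #-}
-- By the balance of the random-walk weighting, ∂ F = 3 Δθ(F) counts the pairs of a non-leaf vertex of F and an
-- incident edge of T∞ missing from F.  Let k = λ(A), a = ∂ A and suppose 30 Φθ(A) < k + 4a.  By (†) and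
-- induction, λ(D) + 4 ∂D < k + 4a for D ≺ A; (‡) with D = E = [] gives 10a < k + 4a; and (‡) gives
-- λ(D) + 4 ∂D + λ(E ⊖ D) + 4 ∂(E ⊖ D) + 10a < 2 (k + 4a) for D, E ≺ A.
-- Take T_x ⊆ A of level k and descend in A as long as a child contains some T_z, z ⊑ x, of level k − r with
-- r ≈ a/4; the children where this stops cover such a T_z together, so if the better one, D, only contains
-- subtrees of level k − r − 1 − t, both meet all 2^t subtrees of T_z one level higher without containing them,
-- whence ∂D ≥ 2^t.  So D trades height for boundary, and since ∂D < 2^s for some s ≤ r, some T_w with w of
-- level k − s is vertex-disjoint from D.  Descend again inside T_w, by ℓ ≈ 4a/3 levels, to some E ≺ A and a
-- largest T_z ⊆ E with z ⊑ w.  If the path from z to w lies in E, every step up it costs E a missing edge and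
-- the bound from (†) fails for E.  Otherwise the component of T_z in E stays inside T_w, hence survives in
-- E ⊖ D, and the bound from (‡) fails for D and E.

module Submission where

-- Numerical inequalities between the parameters of the two descents.

module Arithmetic where

  open import Data.Empty using (⊥; ⊥-elim)
  open import Data.List using ([]; _∷_)
  open import Data.Nat using (ℕ; zero; suc; _+_; _*_; _∸_; _^_; _≤_; _<_; z≤n; s≤s)
  open import Data.Nat.DivMod using (_/_; _%_; m≡m%n+[m/n]*n; m%n<n)
  open import Data.Nat.Properties
  open import Data.Nat.Tactic.RingSolver using (solve)
  open import Data.Product using (_×_; _,_; ∃-syntax)
  open import Data.Sum using (inj₁; inj₂)
  open import Relation.Binary.PropositionalEquality

  -- Linear arithmetic: a weighted sum of hypotheses whose left side exceeds its right side by d + 1.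
  too-large : ∀ {m n} d → m ≤ n → m ≡ n + suc d → ⊥
  too-large {n = n} d m≤n refl = m+1+n≰m n m≤n

  scale : ∀ c {m n} → m ≤ n → c * m ≤ c * n
  scale c = *-monoʳ-≤ c

  infixr 5 _⊞_
  _⊞_ : ∀ {m n p q} → m ≤ n → p ≤ q → m + p ≤ n + q
  _⊞_ = +-mono-≤

  n<2^n : ∀ n → n < 2 ^ n
  n<2^n zero    = s≤s z≤n
  n<2^n (suc n) = +-mono-≤ (≤-trans (s≤s z≤n) (n<2^n n)) (≤-trans (n<2^n n) (m≤m+n _ 0))

  -- The left side grows by `c`, the right side by `2 ^ n`. It yields the two linear bounds below,
  -- the chords of `2 ^ n` through 2, 3 and through 3, 4.
  2^-double : ∀ c d n → c * n ≤ 2 ^ n + d → c ≤ 2 ^ n → c * suc n ≤ 2 ^ suc n + d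
  2^-double c d n ih c≤ = ≤-trans (≤-reflexive (*-suc c n))
    (≤-trans (+-mono-≤ c≤ ih) (≤-reflexive (lemma (2 ^ n))))
    where
    lemma : ∀ p → p + (p + d) ≡ p + (p + 0) + d
    lemma p = solve (p ∷ d ∷ [])

  4n≤2^n+4 : ∀ n → 4 * n ≤ 2 ^ n + 4
  4n≤2^n+4 0 = z≤n
  4n≤2^n+4 1 = m≤m+n 4 2
  4n≤2^n+4 2 = ≤-refl
  4n≤2^n+4 (suc n@(suc (suc m))) = 2^-double 4 4 n (4n≤2^n+4 n) (^-monoʳ-≤ 2 {2} {n} (s≤s (s≤s z≤n)))

  8n≤2^n+16 : ∀ n → 8 * n ≤ 2 ^ n + 16
  8n≤2^n+16 0 = z≤n
  8n≤2^n+16 1 = m≤m+n 8 10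
  8n≤2^n+16 2 = m≤m+n 16 4
  8n≤2^n+16 3 = ≤-refl
  8n≤2^n+16 (suc n@(suc (suc (suc m)))) = 2^-double 8 16 n (8n≤2^n+16 n) (^-monoʳ-≤ 2 {3} {n} (s≤s (s≤s (s≤s z≤n))))

  -- In the following a = ∂ A and k = λ(A); r and s + ℓ are the distances from level k at which the two descents
  -- start, g + 1 + t with t the drop is the level at which a descent starts, and β = ∂ D.  A variable p or b is
  -- a lower bound for ∂ E, with p = 2^t.
  ∃-r : ∀ a → ∃[ r ] 4 * r ≤ a + 12 × 4 * a + r ≤ 3 * 2 ^ r × 3 ≤ r
  ∃-r a = 3 + q , upper , lower , m≤m+n 3 q
    where
    q = a / 4
    ρ = a % 4
    a≡ : a ≡ ρ + q * 4
    a≡ = m≡m%n+[m/n]*n a 4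
    upper : 4 * (3 + q) ≤ a + 12
    upper = ≤-trans (m≤n+m _ ρ) (≤-reflexive (trans (lemma ρ q) (cong (_+ 12) (sym a≡))))
      where
      lemma : ∀ ρ q → ρ + 4 * (3 + q) ≡ ρ + q * 4 + 12
      lemma ρ q = solve (ρ ∷ q ∷ [])
    -- Since `a ≤ 4q + 3`, the left side is at most `17q + 15`; by `q < 2 ^ q` and the offset 3 in
    -- `r`, the right side is at least `24q + 24`.
    lower : 4 * a + (3 + q) ≤ 3 * 2 ^ (3 + q)
    lower = ≮⇒≥ λ lt → sum-contradiction a q ρ (2 ^ q) (≤-reflexive a≡) (m%n<n a 4) (n<2^n q)
      (≤-trans (≤-reflexive (cong (λ p → suc (3 * p)) (lemma (2 ^ q)))) lt)
      where
      lemma : ∀ p → 8 * p ≡ 2 * (2 * (2 * p))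
      lemma p = solve (p ∷ [])
      sum-contradiction : ∀ a q ρ p → a ≤ ρ + q * 4 → ρ < 4 → q < p → 3 * (8 * p) < 4 * a + (3 + q) → ⊥
      sum-contradiction a q ρ p h₁ h₂ h₃ h₄ = too-large (9 + 7 * q)
        (scale 4 h₁ ⊞ scale 4 h₂ ⊞ scale 24 h₃ ⊞ h₄)
        (solve (a ∷ q ∷ ρ ∷ p ∷ []))

  -- Used with `n = 4a + r`. The first inequality makes a climb over `ℓ` levels too expensive, the
  -- second keeps `ℓ` small against `k`.
  ∃-ℓ : ∀ n → 1 ≤ n → ∃[ ℓ ] n ≤ 3 * ℓ + 3 × 3 * ℓ + 1 ≤ n
  ∃-ℓ (suc n) _ = ℓ ,
    ≤-trans (s≤s (≤-reflexive n≡)) (≤-trans (+-monoˡ-≤ (ℓ * 3) (m%n<n n 3)) (≤-reflexive (lemma ℓ))) ,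
    ≤-trans (≤-reflexive (lemma′ ℓ)) (s≤s (≤-trans (m≤n+m (ℓ * 3) (n % 3)) (≤-reflexive (sym n≡))))
    where
    ℓ = n / 3
    n≡ : n ≡ n % 3 + ℓ * 3
    n≡ = m≡m%n+[m/n]*n n 3
    lemma : ∀ ℓ → 3 + ℓ * 3 ≡ 3 * ℓ + 3
    lemma ℓ = solve (ℓ ∷ [])
    lemma′ : ∀ ℓ → 3 * ℓ + 1 ≡ suc (ℓ * 3)
    lemma′ ℓ = solve (ℓ ∷ [])

  -- The second hypothesis says `k > 6a`, whereas `r + ℓ` is at most `(5a + 11) / 3`: both descents
  -- have room.
  scales<k : ∀ a k r ℓ → 1 ≤ a → 10 * a < k + 4 * a → 4 * r ≤ a + 12 → 3 * ℓ + 1 ≤ 4 * a + r → r + ℓ < k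
  scales<k a k r ℓ 1≤a h₁ h₂ h₃ = ≰⇒> λ (k≤ : k ≤ r + ℓ) → too-large 4
    (scale 13 1≤a ⊞ scale 3 h₁ ⊞ h₂ ⊞ h₃ ⊞ scale 3 k≤)
    (solve (a ∷ k ∷ r ∷ ℓ ∷ []))

  -- Inserting the formula for `k` gives `4β < r + t + 1 + 4a`, and `t + 1 ≤ β`.
  ∂-bound : ∀ a k r g t β → g + 4 * β < k + 4 * a → k ≡ r + (t + suc g) → t < β → 3 * β + 1 ≤ 4 * a + r
  ∂-bound a k r g t β h₁ eq t<β = ≮⇒≥ λ (lt : 4 * a + r < 3 * β + 1) → too-large 0
    (h₁ ⊞ ≤-reflexive eq ⊞ t<β ⊞ lt) (solve (a ∷ k ∷ r ∷ g ∷ t ∷ β ∷ []))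

  -- `s` is the smaller of `β` and `r`; if it is `r`, the choice of `r` gives
  -- `3β < 4a + r ≤ 3 * 2 ^ r`.
  ∃-s : ∀ a r β → 3 * β + 1 ≤ 4 * a + r → 4 * a + r ≤ 3 * 2 ^ r → ∃[ s ] ∃[ d ] r ≡ d + s × s ≤ β × β < 2 ^ s
  ∃-s a r β h₁ h₂ with ≤-total β r
  ... | inj₁ β≤r = β , r ∸ β , sym (m∸n+n≡m β≤r) , ≤-refl , n<2^n β
  ... | inj₂ r≤β = r , 0 , refl , r≤β ,
    *-cancelˡ-< 3 β (2 ^ r) (≤-trans (≤-reflexive (+-comm 1 (3 * β))) (≤-trans h₁ h₂))

  -- The last hypothesis gives `b ≥ ℓ + t + 1`; the bound from (†) then gives
  -- `3ℓ + 3t + 3 < s + 4a ≤ r + 4a`, against the choice of `ℓ`.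
  climbed-too-far : ∀ a k r s d ℓ g t b → 4 * a + r ≤ 3 * ℓ + 3 → r ≡ d + s → k ≡ s + (ℓ + (t + suc g)) →
    g + 4 * b < k + 4 * a → ℓ + (t + suc g) ≤ b + g → ⊥
  climbed-too-far a k r s d ℓ g t b h₁ r≡ k≡ h₂ h₃ = too-large (d + 3 * t)
    (h₁ ⊞ ≤-reflexive (sym r≡) ⊞ ≤-reflexive k≡ ⊞ h₂ ⊞ scale 4 h₃)
    (solve (a ∷ k ∷ r ∷ s ∷ d ∷ ℓ ∷ g ∷ t ∷ b ∷ []))

  -- If `g = 0`, then `s + ℓ + t = k - 1`. But `s` and `ℓ` are each at most about `17a/12`, `t` is
  -- at most about `(k + 4a) / 16`, and `k > 6a`.
  level-positive : ∀ a k r s β ℓ g t p → 1 ≤ a → 10 * a < k + 4 * a → 4 * r ≤ a + 12 → 3 * ℓ + 1 ≤ 4 * a + r →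
    s ≤ β → 3 * β + 1 ≤ 4 * a + r → k ≡ s + (ℓ + (t + suc g)) → g + 4 * p < k + 4 * a → 4 * t ≤ p + 4 → 1 ≤ g
  level-positive a k r s β ℓ (suc g) t p _ _ _ _ _ _ _ _ _ = s≤s z≤n
  level-positive a k r s β ℓ zero t p 1≤a h₁ h₂ h₃ h₄ h₅ k≡ h₆ h₇ = ⊥-elim (too-large 9
    (scale 122 1≤a ⊞ scale 45 h₁ ⊞ scale 8 h₂ ⊞ scale 16 h₃ ⊞ scale 48 h₄ ⊞ scale 16 h₅ ⊞
     scale 48 (≤-reflexive k≡) ⊞ scale 3 h₆ ⊞ scale 12 h₇)
    (solve (a ∷ k ∷ r ∷ s ∷ β ∷ ℓ ∷ t ∷ p ∷ [])))

  -- Inserting both formulas for `k` into the bound from (‡) leaves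
  -- `4β + 2a + 2 < r + s + t₁ + ℓ + t₂`. Here `s + t₁ < 2β`, `r + ℓ ≤ (5a + 11) / 3`, and
  -- `31 t₂ ≤ 64 + s + ℓ + 4a` with `s ≤ r`.
  balance-contradiction : ∀ a k r s d β ℓ g₁ t₁ g₂ t₂ p → 4 * r ≤ a + 12 → 3 * ℓ + 1 ≤ 4 * a + r → r ≡ d + s →
    s ≤ β → t₁ < β → k ≡ r + (t₁ + suc g₁) → k ≡ s + (ℓ + (t₂ + suc g₂)) →
    g₂ + 4 * p < k + 4 * a → 8 * t₂ ≤ p + 16 → g₁ + 4 * β + (g₂ + 4) + 10 * a < 2 * (k + 4 * a) → ⊥
  balance-contradiction a k r s d β ℓ g₁ t₁ g₂ t₂ p h₁ h₂ r≡ h₃ h₄ k≡₁ k≡₂ h₅ h₆ h₇ = too-large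
    (14 * a + 13 + 3 * d + 186 * t₁)
    (scale 32 h₁ ⊞ scale 32 h₂ ⊞ scale 3 (≤-reflexive (sym r≡)) ⊞ scale 93 h₃ ⊞ scale 279 h₄ ⊞
     scale 93 (≤-reflexive k≡₁) ⊞ scale 96 (≤-reflexive k≡₂) ⊞ scale 3 h₅ ⊞ scale 12 h₆ ⊞ scale 93 h₇)
    (solve (a ∷ k ∷ r ∷ s ∷ d ∷ β ∷ ℓ ∷ g₁ ∷ t₁ ∷ g₂ ∷ t₂ ∷ p ∷ []))

open Arithmetic
open import Defs
open import Data.Bool using (Bool; true; false; T; not; if_then_else_)
open import Data.Bool.ListAction using (any)
open import Data.Bool.Properties using (T-∧)
open import Data.Empty using (⊥; ⊥-elim)
open import Data.List using (List; []; _∷_; _++_; map; concatMap; filterᵇ; deduplicateᵇ; length; applyUpTo; upTo)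
open import Data.List.Membership.Propositional using (_∈_; _∉_; find; lose)
open import Data.List.Membership.Propositional.Properties
  using (∈-++⁺ˡ; ∈-++⁺ʳ; ∈-++⁻; ∈-filter⁺; ∈-filter⁻; ∈-concatMap⁺; ∈-concatMap⁻; ∈-map⁺; ∈-map⁻;
         ∈-applyUpTo⁺; ∈-applyUpTo⁻; ∈-upTo⁺; ∈-upTo⁻)
open import Data.List.Properties using (map-++; filter-++; filter-all)
open import Data.List.Relation.Binary.Pointwise as Pointwise using (Pointwise; []; _∷_)
open import Data.List.Relation.Unary.All as All using (All; []; _∷_)
open import Data.List.Relation.Unary.All.Properties using (all⁺; all⁻; all-filter)
open import Data.List.Relation.Unary.AllPairs using ([]; _∷_)
import Data.List.Relation.Unary.AllPairs.Properties as AllPairs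
open import Data.List.Relation.Unary.Any as Any using (here; there)
open import Data.List.Relation.Unary.Any.Properties using (any⁺; any⁻; deduplicate⁺; deduplicate⁻)
open import Data.List.Relation.Unary.Unique.Propositional using (Unique)
open import Data.List.Relation.Unary.Unique.Propositional.Properties using (++⁺)
open import Data.Maybe using (just; nothing)
open import Data.Nat as ℕ using (ℕ; zero; suc; z≤n; s≤s; s≤s⁻¹)
open import Data.Nat.ListAction using (sum)
open import Data.Nat.ListAction.Properties using (sum-++)
import Data.Nat.Properties as ℕ
open import Data.Nat.Tactic.RingSolver using (solve-∀)
open import Data.Product using (_×_; _,_; proj₁; proj₂; ∃-syntax)
open import Data.Sum using (_⊎_; inj₁; inj₂; [_,_]′)
open import Data.Unit using (⊤; tt)
open import Function using (_∘_; Equivalence)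
open import Relation.Binary.PropositionalEquality
open import Relation.Nullary using (¬_; Dec; yes; no)
open import Relation.Nullary.Decidable using (does; T?; _×-dec_; decidable-stable)
open import Relation.Unary using (Decidable)

private
  variable
    A B : Set

module Combinatorics where

  open import Data.Nat using (_+_; _*_; _∸_; _^_; _≤_; _<_)
  open import Data.Nat.DivMod using (_/_; _%_; m≡m%n+[m/n]*n; m%n<n; m*n/n≡m; +-distrib-/-∣ʳ)
  open import Data.Nat.Divisibility using (n∣m*n)
  open import Data.Nat.Properties

  -- Membership and vertex sets.

  ==⇒≡ : ∀ u v → T (u == v) → u ≡ v
  ==⇒≡ (a , b) (c , d) p with Equivalence.to T-∧ p
  ... | q , r = cong₂ _,_ (≡ᵇ⇒≡ a c q) (≡ᵇ⇒≡ b d r)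

  ≡⇒== : ∀ {u v} → u ≡ v → T (u == v)
  ≡⇒== {a , b} refl = Equivalence.from T-∧ (≡⇒≡ᵇ a a refl , ≡⇒≡ᵇ b b refl)

  ∈ᵇ⇒∈ : ∀ v xs → T (v ∈ᵇ xs) → v ∈ xs
  ∈ᵇ⇒∈ v xs = Any.map (λ {u} p → sym (==⇒≡ u v p)) ∘ any⁻ (_== v) xs

  ∈⇒∈ᵇ : ∀ {v xs} → v ∈ xs → T (v ∈ᵇ xs)
  ∈⇒∈ᵇ {v} = any⁺ (_== v) ∘ Any.map (λ p → ≡⇒== (sym p))

  _∈?_ : ∀ v (xs : List Vertex) → Dec (v ∈ xs)
  v ∈? xs with T? (v ∈ᵇ xs)
  ... | yes p = yes (∈ᵇ⇒∈ v xs p)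
  ... | no ¬p = no (¬p ∘ ∈⇒∈ᵇ)

  ∈-dedup⁺ : ∀ {v xs} → v ∈ xs → v ∈ deduplicateᵇ _==_ xs
  ∈-dedup⁺ = deduplicate⁺ _ (λ {x} {y} p q → trans q (sym (==⇒≡ _ _ p)))

  ∈-dedup⁻ : ∀ {v xs} → v ∈ deduplicateᵇ _==_ xs → v ∈ xs
  ∈-dedup⁻ = deduplicate⁻ _

  dedup-unique : ∀ xs → Unique (deduplicateᵇ _==_ xs)
  dedup-unique [] = []
  dedup-unique (x ∷ xs) =
    All.map (λ ¬p → ¬p ∘ ≡⇒==) (all-filter _ (deduplicateᵇ _==_ xs)) ∷ AllPairs.filter⁺ _ (dedup-unique xs)

  lower∈V : ∀ {e F} → e ∈ F → e ∈ vertexSet F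
  lower∈V e∈F = ∈-dedup⁺ (∈-concatMap⁺ ends (Any.map (λ { refl → here refl }) e∈F))

  upper∈V : ∀ {e F} → e ∈ F → parent e ∈ vertexSet F
  upper∈V e∈F = ∈-dedup⁺ (∈-concatMap⁺ ends (Any.map (λ { refl → there (here refl) }) e∈F))

  leaf∈V⇒∈ : ∀ {n F} → (0 , n) ∈ vertexSet F → (0 , n) ∈ F
  leaf∈V⇒∈ v∈V = Any.map (λ { (here p) → p ; (there (here ())) }) (∈-concatMap⁻ ends (∈-dedup⁻ v∈V))

  -- The ancestor order.

  child₀ child₁ : ℕ → ℕ → Vertex
  child₀ j n = (j , 2 * n)
  child₁ j n = (j , suc (2 * n))

  parent-child₀ : ∀ j n → parent (child₀ j n) ≡ (suc j , n)
  parent-child₀ j n = cong (suc j ,_) (trans (cong (_/ 2) (*-comm 2 n)) (m*n/n≡m n 2))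

  parent-child₁ : ∀ j n → parent (child₁ j n) ≡ (suc j , n)
  parent-child₁ j n = cong (suc j ,_) (trans (cong (λ m → suc m / 2) (*-comm 2 n))
    (trans (+-distrib-/-∣ʳ 1 {n * 2} {2} (n∣m*n n)) (m*n/n≡m n 2)))

  childView : ∀ j m → (j , m) ≡ child₀ j (m / 2) ⊎ (j , m) ≡ child₁ j (m / 2)
  childView j m with m % 2 | m%n<n m 2 | m≡m%n+[m/n]*n m 2
  ... | 0 | _ | eq = inj₁ (cong (j ,_) (trans eq (*-comm (m / 2) 2)))
  ... | 1 | _ | eq = inj₂ (cong (j ,_) (trans eq (cong suc (*-comm (m / 2) 2))))
  ... | suc (suc _) | s≤s (s≤s ()) | _

  infix 4 _⊑_
  data _⊑_ : Vertex → Vertex → Set where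
    here : ∀ {v} → v ⊑ v
    up   : ∀ {v w} → parent v ⊑ w → v ⊑ w

  ⊑-trans : ∀ {u v w} → u ⊑ v → v ⊑ w → u ⊑ w
  ⊑-trans here   q = q
  ⊑-trans (up p) q = up (⊑-trans p q)

  ⊑-level : ∀ {v w} → v ⊑ w → level v ≤ level w
  ⊑-level here   = ≤-refl
  ⊑-level (up p) = ≤-trans (n≤1+n _) (⊑-level p)

  ⊑-level-≡ : ∀ {v w} → v ⊑ w → level v ≡ level w → v ≡ w
  ⊑-level-≡ here   _  = refl
  ⊑-level-≡ (up p) eq = ⊥-elim (1+n≰n (subst (suc _ ≤_) (sym eq) (⊑-level p)))

  ⊑-unique : ∀ {v a b} → v ⊑ a → v ⊑ b → level a ≡ level b → a ≡ b
  ⊑-unique here   q      eq = ⊑-level-≡ q eq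
  ⊑-unique p      here   eq = sym (⊑-level-≡ p (sym eq))
  ⊑-unique (up p) (up q) eq = ⊑-unique p q eq

  child₀⊑ : ∀ j n → child₀ j n ⊑ (suc j , n)
  child₀⊑ j n = up (subst (_⊑ (suc j , n)) (sym (parent-child₀ j n)) here)

  child₁⊑ : ∀ j n → child₁ j n ⊑ (suc j , n)
  child₁⊑ j n = up (subst (_⊑ (suc j , n)) (sym (parent-child₁ j n)) here)

  data BelowView (j n : ℕ) (v : Vertex) : Set where
    root  : v ≡ (suc j , n) → BelowView j n v
    left  : v ⊑ child₀ j n → BelowView j n v
    right : v ⊑ child₁ j n → BelowView j n v

  belowView : ∀ {j n v} → v ⊑ (suc j , n) → BelowView j n v
  belowView here = root refl
  belowView {v = i , m} (up p) with belowView p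
  ... | left q  = left (up q)
  ... | right q = right (up q)
  ... | root refl with childView i m
  ...   | inj₁ eq = left (subst (_⊑ child₀ i (m / 2)) (sym eq) here)
  ...   | inj₂ eq = right (subst (_⊑ child₁ i (m / 2)) (sym eq) here)

  below-leaf : ∀ {n v} → v ⊑ (0 , n) → v ≡ (0 , n)
  below-leaf p = ⊑-level-≡ p (n≤0⇒n≡0 (⊑-level p))

  -- Complete subtrees and λ.

  -- A form of `Tsubᵇ` that splits T_x at its root instead of listing its edges level by level, as
  -- the inductions below need.
  FullAt : Graph → ℕ → ℕ → Set
  FullAt F zero    n = ⊤
  FullAt F (suc j) n = (child₀ j n ∈ F × FullAt F j (2 * n)) × (child₁ j n ∈ F × FullAt F j (suc (2 * n)))

  Full : Graph → Vertex → Set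
  Full F (k , n) = FullAt F k n

  full? : ∀ F k n → Dec (Full F (k , n))
  full? F zero    n = yes tt
  full? F (suc j) n = ((_ ∈? F) ×-dec full? F j _) ×-dec ((_ ∈? F) ×-dec full? F j _)

  Full-⊑ : ∀ {F v w} → v ⊑ w → Full F w → Full F v
  Full-⊑ here full = full
  Full-⊑ {F} {v = i , m} (up p) full with Full-⊑ p full | childView i m
  ... | (_ , f₀) , _ | inj₁ eq = subst (Full F) (sym eq) f₀
  ... | _ , (_ , f₁) | inj₂ eq = subst (Full F) (sym eq) f₁

  Full-mono : ∀ {F G} k n → (∀ {e} → e ⊑ (k , n) → e ∈ F → e ∈ G) → Full F (k , n) → Full G (k , n)
  Full-mono zero    n F⊆G _ = tt
  Full-mono (suc j) n F⊆G ((e₀ , f₀) , (e₁ , f₁)) =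
    (F⊆G (child₀⊑ j n) e₀ , Full-mono j _ (λ p → F⊆G (⊑-trans p (child₀⊑ j n))) f₀) ,
    (F⊆G (child₁⊑ j n) e₁ , Full-mono j _ (λ p → F⊆G (⊑-trans p (child₁⊑ j n))) f₁)

  -- The edges of T_(k,n), grouped by their depth d + 1 below (k , n).
  Full⇒edge : ∀ {F} d i n r → r < 2 ^ suc d → Full F (suc d + i , n) → (i , n * 2 ^ suc d + r) ∈ F
  Full⇒edge {F} zero i n 0 _ ((e , _) , _) = subst (λ m → (i , m) ∈ F) (eq n) e
    where
    eq : ∀ n → 2 * n ≡ n * 2 + 0
    eq = solve-∀
  Full⇒edge {F} zero i n 1 _ (_ , (e , _)) = subst (λ m → (i , m) ∈ F) (eq n) e
    where
    eq : ∀ n → suc (2 * n) ≡ n * 2 + 1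
    eq = solve-∀
  Full⇒edge zero i n (suc (suc r)) (s≤s (s≤s ())) _
  Full⇒edge {F} (suc d) i n r r< ((_ , f₀) , (_ , f₁)) with <-≤-connex r (2 ^ suc d)
  ... | inj₁ r<′ = subst (λ m → (i , m) ∈ F) (eq n (2 ^ suc d) r) (Full⇒edge d i (2 * n) r r<′ f₀)
    where
    eq : ∀ n p r → 2 * n * p + r ≡ n * (2 * p) + r
    eq = solve-∀
  ... | inj₂ p≤r = subst (λ m → (i , m) ∈ F)
    (trans (eq n (2 ^ suc d) (r ∸ 2 ^ suc d)) (cong (n * 2 ^ suc (suc d) +_) (m+[n∸m]≡n p≤r)))
    (Full⇒edge d i (suc (2 * n)) (r ∸ 2 ^ suc d) r∸< f₁)
    where
    eq : ∀ n p s → suc (2 * n) * p + s ≡ n * (2 * p) + (p + s)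
    eq = solve-∀
    r∸< : r ∸ 2 ^ suc d < 2 ^ suc d
    r∸< = +-cancelˡ-< (2 ^ suc d) _ _ (subst₂ _<_ (sym (m+[n∸m]≡n p≤r)) (cong (2 ^ suc d +_) (+-identityʳ _)) r<)

  edges⇒Full : ∀ {F} k n → (∀ d i r → suc d + i ≡ k → r < 2 ^ suc d → (i , n * 2 ^ suc d + r) ∈ F) → Full F (k , n)
  edges⇒Full zero n _ = tt
  edges⇒Full {F} (suc k) n edges =
    (subst (λ m → (k , m) ∈ F) (eq₀ n) (edges 0 k 0 refl (s≤s z≤n)) ,
     edges⇒Full k (2 * n) λ d i r eq r< →
       subst (λ m → (i , m) ∈ F) (eq₂ n (2 ^ suc d) r)
         (edges (suc d) i r (cong suc eq) (<-≤-trans r< (m≤m+n (2 ^ suc d) _)))) ,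
    (subst (λ m → (k , m) ∈ F) (eq₁ n) (edges 0 k 1 refl (s≤s (s≤s z≤n))) ,
     edges⇒Full k (suc (2 * n)) λ d i r eq r< →
       subst (λ m → (i , m) ∈ F) (eq₃ n (2 ^ suc d) r)
         (edges (suc d) i (2 ^ suc d + r) (cong suc eq)
           (subst (2 ^ suc d + r <_) (cong (2 ^ suc d +_) (sym (+-identityʳ _))) (+-monoʳ-< (2 ^ suc d) r<))))
    where
    eq₀ : ∀ n → n * 2 + 0 ≡ 2 * n
    eq₀ = solve-∀
    eq₁ : ∀ n → n * 2 + 1 ≡ suc (2 * n)
    eq₁ = solve-∀
    eq₂ : ∀ n p r → n * (2 * p) + r ≡ 2 * n * p + r
    eq₂ = solve-∀
    eq₃ : ∀ n p r → n * (2 * p) + (p + r) ≡ suc (2 * n) * p + r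
    eq₃ = solve-∀

  Full⇒Tsub : ∀ F v → Full F v → T (Tsubᵇ v F)
  Full⇒Tsub F (k , n) full = all⁻ (_∈ᵇ F) (All.tabulate in-F)
    where
    in-F : ∀ {e} → e ∈ edgesOfT (k , n) → T (e ∈ᵇ F)
    in-F e∈ with find (∈-concatMap⁻ _ {upTo k} e∈)
    ... | i , i∈ , e∈′ with ∈-applyUpTo⁻ _ e∈′ | m≤n⇒∃[o]m+o≡n (∈-upTo⁻ i∈)
    ...   | r , r< , refl | d , refl =
      ∈⇒∈ᵇ (subst (λ p → (i , n * 2 ^ p + r) ∈ F) (sym eq)
        (Full⇒edge d i n r (subst (λ p → r < 2 ^ p) eq r<) (subst (λ l → Full F (l , n)) (cong suc (+-comm i d)) full)))
      where
      eq : suc (i + d) ∸ i ≡ suc d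
      eq = trans (cong (_∸ i) (sym (+-suc i d))) (m+n∸m≡n i (suc d))

  Tsub⇒Full : ∀ F v → T (Tsubᵇ v F) → Full F v
  Tsub⇒Full F (k , n) tsub = edges⇒Full k n λ d i r eq r< →
    ∈ᵇ⇒∈ _ F (All.lookup (all⁺ (_∈ᵇ F) _ tsub)
      (∈-concatMap⁺ _ (lose (∈-upTo⁺ (subst (i <_) eq (s≤s (m≤n+m i d))))
        (subst (λ p → (i , n * 2 ^ p + r) ∈ applyUpTo (λ r → (i , n * 2 ^ (k ∸ i) + r)) (2 ^ (k ∸ i)))
          (lem d i eq) (∈-applyUpTo⁺ (λ r → (i , n * 2 ^ (k ∸ i) + r)) (subst (λ p → r < 2 ^ p) (sym (lem d i eq)) r<))))))
    where
    lem : ∀ d i → suc d + i ≡ k → k ∸ i ≡ suc d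
    lem d i refl = m+n∸n≡m (suc d) i

  ≤-maxℕ : ∀ {n ns} → n ∈ ns → n ≤ maxℕ ns
  ≤-maxℕ (here refl) = m≤m⊔n _ _
  ≤-maxℕ {ns = m ∷ ns} (there n∈) = ≤-trans (≤-maxℕ n∈) (m≤n⊔m m _)

  maxℕ-attained : ∀ ns → maxℕ ns ≡ 0 ⊎ maxℕ ns ∈ ns
  maxℕ-attained [] = inj₁ refl
  maxℕ-attained (m ∷ ns) with ⊔-sel m (maxℕ ns) | maxℕ-attained ns
  ... | inj₁ eq | _       = inj₂ (here eq)
  ... | inj₂ eq | inj₁ z  = inj₁ (trans eq z)
  ... | inj₂ eq | inj₂ n∈ = inj₂ (there (subst (_∈ ns) (sym eq) n∈))

  -- `λG` inspects only vertices of `F`; the root of a complete subtree is one, as the upper end of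
  -- a child edge.
  Full⇒level≤λ : ∀ F v → Full F v → level v ≤ λG F
  Full⇒level≤λ F (zero , n) _ = z≤n
  Full⇒level≤λ F (suc j , n) full@((e₀ , _) , _) = ≤-maxℕ (∈-map⁺ level (∈-filter⁺ _
    (subst (_∈ vertexSet F) (parent-child₀ j n) (upper∈V e₀)) (Full⇒Tsub F (suc j , n) full)))

  λ-attained : ∀ F → ∃[ v ] level v ≡ λG F × Full F v
  λ-attained F with maxℕ-attained (map level (filterᵇ (λ x → Tsubᵇ x F) (vertexSet F)))
  -- The default value 0 of the maximum is attained at any leaf, whose tree has no edges.
  ... | inj₁ eq = (0 , 0) , sym eq , tt
  ... | inj₂ λ∈ with ∈-map⁻ level λ∈
  ...   | v , v∈ , eq = v , sym eq , Tsub⇒Full F v (proj₂ (∈-filter⁻ (λ x → T? (Tsubᵇ x F)) {xs = vertexSet F} v∈))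


  -- Finite sums.

  ∑ : List A → (A → ℕ) → ℕ
  ∑ xs f = sum (map f xs)

  ∑-cong : ∀ {f g : A → ℕ} xs → (∀ {x} → x ∈ xs → f x ≡ g x) → ∑ xs f ≡ ∑ xs g
  ∑-cong []       eq = refl
  ∑-cong (x ∷ xs) eq = cong₂ _+_ (eq (here refl)) (∑-cong xs (eq ∘ there))

  ∑-++ : ∀ (f : A → ℕ) xs ys → ∑ (xs ++ ys) f ≡ ∑ xs f + ∑ ys f
  ∑-++ f xs ys = trans (cong sum (map-++ f xs ys)) (sum-++ (map f xs) (map f ys))

  ∑-+ : ∀ (f g : A → ℕ) xs → ∑ xs (λ x → f x + g x) ≡ ∑ xs f + ∑ xs g
  ∑-+ f g []       = refl
  ∑-+ f g (x ∷ xs) = trans (cong (f x + g x +_) (∑-+ f g xs)) (+-exchange (f x) (g x) (∑ xs f) (∑ xs g))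
    where
    +-exchange : ∀ a b c d → a + b + (c + d) ≡ a + c + (b + d)
    +-exchange = solve-∀

  ∑-*ˡ : ∀ c (f : A → ℕ) xs → ∑ xs (λ x → c * f x) ≡ c * ∑ xs f
  ∑-*ˡ c f []       = sym (*-zeroʳ c)
  ∑-*ˡ c f (x ∷ xs) = trans (cong (c * f x +_) (∑-*ˡ c f xs)) (sym (*-distribˡ-+ c (f x) (∑ xs f)))

  ∑-const : ∀ c (xs : List A) → ∑ xs (λ _ → c) ≡ length xs * c
  ∑-const c []       = refl
  ∑-const c (x ∷ xs) = cong (c +_) (∑-const c xs)

  ∑-swap : ∀ (f : A → B → ℕ) xs ys → ∑ xs (λ x → ∑ ys (f x)) ≡ ∑ ys (λ y → ∑ xs (λ x → f x y))
  ∑-swap f []       ys = sym (trans (∑-const 0 ys) (*-zeroʳ (length ys)))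
  ∑-swap f (x ∷ xs) ys = trans (cong (∑ ys (f x) +_) (∑-swap f xs ys)) (sym (∑-+ (f x) _ ys))

  ∑-extract : ∀ (f : A → ℕ) {x ys} → x ∈ ys →
    ∃[ ys′ ] ∑ ys f ≡ f x + ∑ ys′ f × (∀ {z} → z ∈ ys → z ≢ x → z ∈ ys′)
  ∑-extract f {ys = y ∷ ys} (here refl) = ys , refl , λ
    { (here eq) z≢x → ⊥-elim (z≢x eq) ; (there z∈) _ → z∈ }
  ∑-extract f {x} {y ∷ ys} (there x∈) with ∑-extract f x∈
  ... | ys′ , eq , others = y ∷ ys′ , trans (cong (f y +_) eq) (+-swap (f y) (f x) (∑ ys′ f)) , λ
    { (here eq) _ → here eq ; (there z∈) z≢x → there (others z∈ z≢x) }
    where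
    +-swap : ∀ a b c → a + (b + c) ≡ b + (a + c)
    +-swap = solve-∀

  -- Every element of `xs` with nonzero value is matched with an occurrence in `ys`, which is then
  -- removed; as `xs` has no repetitions, the later matches remain available.
  ∑-mono-support : ∀ (f : A → ℕ) {xs ys} → Unique xs →
    (∀ {x} → x ∈ xs → f x ≡ 0 ⊎ x ∈ ys) → ∑ xs f ≤ ∑ ys f
  ∑-mono-support f {[]} [] _ = z≤n
  ∑-mono-support f {x ∷ xs} {ys} (x∉xs ∷ uniq) support with support (here refl)
  ... | inj₁ eq = subst (λ n → n + ∑ xs f ≤ ∑ ys f) (sym eq) (∑-mono-support f uniq (support ∘ there))
  ... | inj₂ x∈ys with ∑-extract f x∈ys
  ...   | ys′ , eq , others = subst (f x + ∑ xs f ≤_) (sym eq) (+-monoʳ-≤ (f x) (∑-mono-support f uniq support′))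
    where
    support′ : ∀ {z} → z ∈ xs → f z ≡ 0 ⊎ z ∈ ys′
    support′ z∈ with support (there z∈)
    ... | inj₁ eq   = inj₁ eq
    ... | inj₂ z∈ys = inj₂ (others z∈ys (λ z≡x → All.lookup x∉xs z∈ (sym z≡x)))

  -- Balance of the weighting and the boundary count.

  δ : Vertex → Vertex → ℕ
  δ u v = if u == v then 1 else 0

  δ-≡ : ∀ u v → u ≡ v → δ u v ≡ 1
  δ-≡ u v eq with u == v | ≡⇒== eq
  ... | true | _ = refl

  δ-≢ : ∀ u v → u ≢ v → δ u v ≡ 0
  δ-≢ u v neq with u == v in eq
  ... | true  = ⊥-elim (neq (==⇒≡ u v (subst T (sym eq) _)))
  ... | false = refl

  count : List Vertex → Vertex → ℕ
  count xs v = ∑ xs (λ x → δ x v)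

  count-∉ : ∀ {v} xs → v ∉ xs → count xs v ≡ 0
  count-∉ []       _   = refl
  count-∉ {v} (x ∷ xs) v∉ = cong₂ _+_ (δ-≢ x v (λ eq → v∉ (here (sym eq)))) (count-∉ xs (v∉ ∘ there))

  count-∈ : ∀ {v xs} → Unique xs → v ∈ xs → count xs v ≡ 1
  count-∈ {xs = x ∷ xs} (x∉ ∷ _) (here refl) =
    cong₂ _+_ (δ-≡ x x refl) (count-∉ xs (λ x∈ → All.lookup x∉ x∈ refl))
  count-∈ {v} {x ∷ xs} (x∉ ∷ u) (there v∈) = cong₂ _+_ (δ-≢ x v (All.lookup x∉ v∈)) (count-∈ u v∈)

  count≤1 : ∀ {v xs} → Unique xs → count xs v ≤ 1
  count≤1 {v} {xs} u with v ∈? xs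
  ... | yes v∈ = ≤-reflexive (count-∈ u v∈)
  ... | no  v∉ = subst (_≤ 1) (sym (count-∉ xs v∉)) z≤n

  -- 3 θ(e) = weight (lower end) + 1: three times the probabilities with which the
  -- random walk crosses e upwards and downwards.
  weight : Vertex → ℕ
  weight (zero  , _) = 3
  weight (suc _ , _) = 1

  -- Each edge hands `weight e` to its lower end and 1 to its upper end. A leaf gets 3 from its only
  -- edge and an inner vertex 1 from each of its three, so 3 is the full amount everywhere.
  incidence : List Edge → Vertex → ℕ
  incidence es v = weight v * count es v + ∑ es (λ e → δ (parent e) v)

  ∑-incidence : ∀ {es vs} → Unique vs → (∀ {e} → e ∈ es → e ∈ vs × parent e ∈ vs) →
    ∑ vs (incidence es) ≡ ∑ es (λ e → weight e + 1)
  ∑-incidence {es} {vs} uniq ends∈ = begin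
    ∑ vs (incidence es)
      ≡⟨ ∑-cong vs (λ {v} _ → trans (cong (_+ ∑ es (λ e → δ (parent e) v)) (sym (∑-*ˡ (weight v) (λ e → δ e v) es)))
           (sym (∑-+ (λ e → weight v * δ e v) (λ e → δ (parent e) v) es))) ⟩
    ∑ vs (λ v → ∑ es (λ e → weight v * δ e v + δ (parent e) v))
      ≡⟨ ∑-swap (λ v e → weight v * δ e v + δ (parent e) v) vs es ⟩
    ∑ es (λ e → ∑ vs (λ v → weight v * δ e v + δ (parent e) v))
      ≡⟨ ∑-cong es (λ {e} e∈ → trans (∑-cong vs (λ {v} _ → cong₂ _+_ (at-end e v) (δ-comm (parent e) v)))
           (trans (∑-+ (λ v → weight e * δ v e) (λ v → δ v (parent e)) vs)
           (cong₂ _+_ (trans (∑-*ˡ (weight e) (λ v → δ v e) vs)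
                        (trans (cong (weight e *_) (count-∈ uniq (proj₁ (ends∈ e∈)))) (*-identityʳ _)))
                      (count-∈ uniq (proj₂ (ends∈ e∈)))))) ⟩
    ∑ es (λ e → weight e + 1) ∎
    where
    open ≡-Reasoning
    δ-comm : ∀ u v → δ u v ≡ δ v u
    δ-comm u v with u == v in eq
    ... | true  = sym (δ-≡ v u (sym (==⇒≡ u v (subst T (sym eq) _))))
    ... | false = sym (δ-≢ v u λ v≡u → subst T eq (≡⇒== (sym v≡u)))
    at-end : ∀ e v → weight v * δ e v ≡ weight e * δ v e
    at-end e v with e == v in eq
    ... | false = trans (*-zeroʳ (weight v)) (sym (trans (cong (weight e *_)
                    (δ-≢ v e λ v≡e → subst T eq (≡⇒== (sym v≡e)))) (*-zeroʳ (weight e))))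
    ... | true with ==⇒≡ e v (subst T (sym eq) _)
    ...   | refl = cong (weight e *_) (sym (δ-≡ e e refl))

  incidence-leaf : ∀ es n → incidence es (0 , n) ≡ 3 * count es (0 , n)
  incidence-leaf es n = trans (cong (3 * count es (0 , n) +_)
    (trans (∑-cong es (λ _ → refl)) (trans (∑-const 0 es) (*-zeroʳ (length es))))) (+-identityʳ _)

  incidence-inner : ∀ es j n → incidence es (suc j , n) ≡
    count es (suc j , n) + (count es (child₀ j n) + count es (child₁ j n))
  incidence-inner es j n = cong₂ _+_ (*-identityˡ _)
    (trans (∑-cong es (λ {e} _ → split e)) (∑-+ (λ e → δ e (child₀ j n)) (λ e → δ e (child₁ j n)) es))
    where
    child₀≢child₁ : child₀ j n ≢ child₁ j n
    child₀≢child₁ eq = even≢odd n n (cong proj₂ eq)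
    split : ∀ e → δ (parent e) (suc j , n) ≡ δ e (child₀ j n) + δ e (child₁ j n)
    split e@(i , m) with e ∈? (child₀ j n ∷ child₁ j n ∷ [])
    ... | yes (here refl) = trans (δ-≡ _ _ (parent-child₀ j n))
      (sym (cong₂ _+_ (δ-≡ e e refl) (δ-≢ (child₀ j n) (child₁ j n) child₀≢child₁)))
    ... | yes (there (here refl)) = trans (δ-≡ _ _ (parent-child₁ j n))
      (sym (cong₂ _+_ (δ-≢ (child₁ j n) (child₀ j n) (child₀≢child₁ ∘ sym)) (δ-≡ e e refl)))
    ... | no e∉ = trans (δ-≢ (parent e) _ not-parent)
      (sym (cong₂ _+_ (δ-≢ e _ (e∉ ∘ here)) (δ-≢ e _ (e∉ ∘ there ∘ here))))
      where
      not-parent : parent e ≢ (suc j , n)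
      not-parent eq with belowView {j} {n} {e} (up (subst (_⊑ (suc j , n)) (sym eq) here))
      ... | root refl = 1+n≢n (cong proj₁ eq)
      ... | left  p = e∉ (here (⊑-level-≡ p (suc-injective (cong proj₁ eq))))
      ... | right p = e∉ (there (here (⊑-level-≡ p (suc-injective (cong proj₁ eq)))))

  incidence≤3 : ∀ {es} → Unique es → ∀ v → incidence es v ≤ 3
  incidence≤3 {es} u (zero  , n) = subst (_≤ 3) (sym (incidence-leaf es n)) (*-monoʳ-≤ 3 (count≤1 {0 , n} u))
  incidence≤3 {es} u (suc j , n) = subst (_≤ 3) (sym (incidence-inner es j n))
    (+-mono-≤ (count≤1 {suc j , n} u) (+-mono-≤ (count≤1 {child₀ j n} u) (count≤1 {child₁ j n} u)))

  deficit : Graph → Vertex → ℕ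
  deficit F v = 3 ∸ incidence (edgeSet F) v

  opaque
    ∂ : Graph → ℕ
    ∂ F = ∑ (vertexSet F) (deficit F)

    ∂-def : ∀ F → ∂ F ≡ ∑ (vertexSet F) (deficit F)
    ∂-def F = refl

  -- The amount 3 at each vertex is what its edges in `F` deliver plus its deficit; summing the
  -- deliveries by edges instead gives `3 θ(e)` per edge.
  ∂-balance : ∀ F → length (vertexSet F) * 3 ≡ ∑ (edgeSet F) (λ e → weight e + 1) + ∂ F
  ∂-balance F = begin
    length (vertexSet F) * 3
      ≡⟨ sym (∑-const 3 (vertexSet F)) ⟩
    ∑ (vertexSet F) (λ _ → 3)
      ≡⟨ ∑-cong (vertexSet F) (λ {v} _ → sym (m+[n∸m]≡n (incidence≤3 (dedup-unique F) v))) ⟩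
    ∑ (vertexSet F) (λ v → incidence (edgeSet F) v + deficit F v)
      ≡⟨ ∑-+ (incidence (edgeSet F)) (deficit F) (vertexSet F) ⟩
    ∑ (vertexSet F) (incidence (edgeSet F)) + ∑ (vertexSet F) (deficit F)
      ≡⟨ cong₂ _+_ (∑-incidence {edgeSet F} (dedup-unique (concatMap ends F))
           (λ e∈ → lower∈V {F = F} (∈-dedup⁻ e∈) , upper∈V {F = F} (∈-dedup⁻ e∈))) (sym (∂-def F)) ⟩
    ∑ (edgeSet F) (λ e → weight e + 1) + ∂ F ∎
    where open ≡-Reasoning

  -- Missing edges inside a subtree.

  -- Off `F` the deficit would be 3. With 0 there, sums over all vertices of some T_x are bounded by
  -- `∂ F`.
  gap : Graph → Vertex → ℕ
  gap F v = if does (v ∈? vertexSet F) then deficit F v else 0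

  gap-∈ : ∀ F {v} → v ∈ vertexSet F → gap F v ≡ deficit F v
  gap-∈ F {v} v∈ with v ∈? vertexSet F
  ... | yes _  = refl
  ... | no  v∉ = ⊥-elim (v∉ v∈)

  data Missing (F : Graph) : Vertex → Set where
    above  : ∀ {j n} → (suc j , n) ∉ F → Missing F (suc j , n)
    below₀ : ∀ {j n} → child₀ j n ∉ F → Missing F (suc j , n)
    below₁ : ∀ {j n} → child₁ j n ∉ F → Missing F (suc j , n)

  gap-missing : ∀ {F v} → v ∈ vertexSet F → Missing F v → 1 ≤ gap F v
  gap-missing {F} {suc j , n} v∈ missing = subst (1 ≤_) (sym (gap-∈ F v∈)) (m<n⇒0<n∸m
    (subst (_< 3) (sym (incidence-inner (edgeSet F) j n)) (s≤s (bound missing))))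
    where
    ES = edgeSet F
    c≤1 : ∀ v → count ES v ≤ 1
    c≤1 v = count≤1 {v} (dedup-unique F)
    absent : ∀ v → v ∉ F → count ES v ≤ 0
    absent v v∉ = ≤-reflexive (count-∉ ES (v∉ ∘ ∈-dedup⁻))
    bound : Missing F (suc j , n) → count ES (suc j , n) + (count ES (child₀ j n) + count ES (child₁ j n)) ≤ 2
    bound (above  e∉) = +-mono-≤ (absent _ e∉) (+-mono-≤ (c≤1 (child₀ j n)) (c≤1 (child₁ j n)))
    bound (below₀ e∉) = +-mono-≤ (c≤1 (suc j , n)) (+-mono-≤ (absent _ e∉) (c≤1 (child₁ j n)))
    bound (below₁ e∉) = +-mono-≤ (c≤1 (suc j , n)) (+-mono-≤ (c≤1 (child₀ j n)) (absent _ e∉))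

  below : ℕ → ℕ → List Vertex
  below zero    n = (0 , n) ∷ []
  below (suc j) n = (suc j , n) ∷ below j (2 * n) ++ below j (suc (2 * n))

  below⇒⊑ : ∀ k n {v} → v ∈ below k n → v ⊑ (k , n)
  below⇒⊑ zero    n (here refl) = here
  below⇒⊑ (suc j) n (here refl) = here
  below⇒⊑ (suc j) n (there v∈) with ∈-++⁻ (below j (2 * n)) v∈
  ... | inj₁ v∈₀ = ⊑-trans (below⇒⊑ j _ v∈₀) (child₀⊑ j n)
  ... | inj₂ v∈₁ = ⊑-trans (below⇒⊑ j _ v∈₁) (child₁⊑ j n)

  below-unique : ∀ k n → Unique (below k n)
  below-unique zero    n = [] ∷ []
  below-unique (suc j) n =
    All.tabulate root-fresh ∷ ++⁺ (below-unique j _) (below-unique j _) (λ (v∈₀ , v∈₁) →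
      even≢odd n n (cong proj₂ (⊑-unique (below⇒⊑ j (2 * n) v∈₀) (below⇒⊑ j (suc (2 * n)) v∈₁) refl)))
    where
    root-fresh : ∀ {v} → v ∈ below j (2 * n) ++ below j (suc (2 * n)) → (suc j , n) ≢ v
    root-fresh v∈ refl with ∈-++⁻ (below j (2 * n)) v∈
    ... | inj₁ v∈₀ = 1+n≰n (⊑-level (below⇒⊑ j _ v∈₀))
    ... | inj₂ v∈₁ = 1+n≰n (⊑-level (below⇒⊑ j _ v∈₁))

  gapsAt : Graph → ℕ → ℕ → ℕ
  gapsAt F k n = ∑ (below k n) (gap F)

  gaps : Graph → Vertex → ℕ
  gaps F (k , n) = gapsAt F k n

  gaps-split : ∀ F j n → gaps F (suc j , n) ≡ gap F (suc j , n) + (gaps F (child₀ j n) + gaps F (child₁ j n))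
  gaps-split F j n = cong (gap F (suc j , n) +_) (∑-++ (gap F) (below j (2 * n)) _)

  gap≤gaps : ∀ F v → gap F v ≤ gaps F v
  gap≤gaps F (zero  , n) = m≤m+n _ 0
  gap≤gaps F (suc j , n) = m≤m+n _ _

  gaps≤∂ : ∀ F v → gaps F v ≤ ∂ F
  gaps≤∂ F (k , n) = ≤-trans
    (∑-mono-support (gap F) (below-unique k n) support)
    (≤-reflexive (trans (∑-cong (vertexSet F) (gap-∈ F)) (sym (∂-def F))))
    where
    support : ∀ {v} → v ∈ below k n → gap F v ≡ 0 ⊎ v ∈ vertexSet F
    support {v} _ with v ∈? vertexSet F
    ... | yes v∈ = inj₂ v∈
    ... | no  v∉ = inj₁ refl

  gaps-mono : ∀ F {v w} → v ⊑ w → gaps F v ≤ gaps F w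
  gaps-mono F here = ≤-refl
  gaps-mono F {i , m} (up p) = ≤-trans (to-parent (childView i m)) (gaps-mono F p)
    where
    to-parent : _ → gaps F (i , m) ≤ gaps F (suc i , m / 2)
    to-parent (inj₁ eq) = subst₂ (λ v → gaps F v ≤_) (sym eq) (sym (gaps-split F i (m / 2)))
      (≤-trans (m≤m+n _ _) (m≤n+m _ (gap F (suc i , m / 2))))
    to-parent (inj₂ eq) = subst₂ (λ v → gaps F v ≤_) (sym eq) (sym (gaps-split F i (m / 2)))
      (≤-trans (m≤n+m _ (gaps F (child₀ i (m / 2)))) (m≤n+m _ (gap F (suc i , m / 2))))

  -- Walking down edges of `F` into incomplete subtrees must stop at a vertex with a missing child
  -- edge, since at level 0 every tree is complete.
  notFull⇒gap : ∀ F k n → (k , n) ∈ vertexSet F → ¬ Full F (k , n) → 1 ≤ gaps F (k , n)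
  notFull⇒gap F zero    n _  ¬full = ⊥-elim (¬full _)
  notFull⇒gap F (suc j) n v∈ ¬full with child₀ j n ∈? F | child₁ j n ∈? F
  ... | no e∉ | _ = ≤-trans (gap-missing {F} v∈ (below₀ e∉)) (gap≤gaps F (suc j , n))
  ... | _ | no e∉ = ≤-trans (gap-missing {F} v∈ (below₁ e∉)) (gap≤gaps F (suc j , n))
  ... | yes e₀ | yes e₁ with full? F j (2 * n)
  ...   | no ¬f₀ = ≤-trans (notFull⇒gap F j _ (lower∈V e₀) ¬f₀) (gaps-mono F (child₀⊑ j n))
  ...   | yes f₀ = ≤-trans (notFull⇒gap F j _ (lower∈V e₁) (λ f₁ → ¬full ((e₀ , f₀) , (e₁ , f₁))))
                     (gaps-mono F (child₁⊑ j n))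

  -- Climbing from `v` either meets a missing upward edge or reaches `w`, where `notFull⇒gap`
  -- applies. A leaf of `F` always has its upward edge.
  touched⇒gap : ∀ F {v w} → v ⊑ w → v ∈ vertexSet F → ¬ Full F w → 1 ≤ gaps F w
  touched⇒gap F {k , n} here v∈ ¬full = notFull⇒gap F k n v∈ ¬full
  touched⇒gap F {v} (up p) v∈ ¬full with v ∈? F
  ... | yes e∈ = touched⇒gap F p (upper∈V e∈) ¬full
  touched⇒gap F {zero  , n} (up p) v∈ ¬full | no e∉ = ⊥-elim (e∉ (leaf∈V⇒∈ v∈))
  touched⇒gap F {suc j , n} (up p) v∈ ¬full | no e∉ =
    ≤-trans (gap-missing {F} v∈ (above e∉)) (≤-trans (gap≤gaps F (suc j , n)) (gaps-mono F (up p)))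

  -- Subtrees that are met, avoided or contained.

  any-below? : ∀ {P : Vertex → Set} → Decidable P → ∀ k n →
    (∃[ v ] v ⊑ (k , n) × P v) ⊎ (∀ {v} → v ⊑ (k , n) → ¬ P v)
  any-below? P? k n with P? (k , n)
  any-below? P? k       n | yes p = inj₁ (_ , here , p)
  any-below? {P} P? zero    n | no ¬p = inj₂ λ v⊑ → ¬p ∘ subst P (below-leaf v⊑)
  any-below? P? (suc j) n | no ¬p with any-below? P? j (2 * n) | any-below? P? j (suc (2 * n))
  ... | inj₁ (v , v⊑ , p) | _ = inj₁ (v , ⊑-trans v⊑ (child₀⊑ j n) , p)
  ... | inj₂ _ | inj₁ (v , v⊑ , p) = inj₁ (v , ⊑-trans v⊑ (child₁⊑ j n) , p)
  ... | inj₂ none₀ | inj₂ none₁ = inj₂ λ v⊑ → case-below (belowView v⊑)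
    where
    case-below : ∀ {v} → BelowView j n v → ¬ _
    case-below (root refl) = ¬p
    case-below (left v⊑)   = none₀ v⊑
    case-below (right v⊑)  = none₁ v⊑

  Untouched : List Vertex → Vertex → Set
  Untouched S w = ∀ {v} → v ⊑ w → v ∉ S

  untouched⇒Full : ∀ {F G H} k n → (∀ {e} → e ∈ H → e ∈ F ⊎ e ∈ G) →
    Untouched (vertexSet F) (k , n) → Full H (k , n) → Full G (k , n)
  untouched⇒Full k n H⊆F∪G untouched = Full-mono k n λ e⊑ e∈H →
    [ (λ e∈F → ⊥-elim (untouched e⊑ (lower∈V e∈F))) , (λ e∈G → e∈G) ]′ (H⊆F∪G e∈H)

  HasFull : Graph → Vertex → ℕ → Set
  HasFull F y h = ∃[ z ] z ⊑ y × level z ≡ h × Full F z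

  NoFull : Graph → Vertex → ℕ → Set
  NoFull F y h = ∀ {z} → z ⊑ y → level z ≡ h → ¬ Full F z

  hasFull? : ∀ F y h → HasFull F y h ⊎ NoFull F y h
  hasFull? F (k , n) h
    with any-below? {λ z → level z ≡ h × Full F z} (λ z → (level z ≟ h) ×-dec full? F (level z) (proj₂ z)) k n
  ... | inj₁ has  = inj₁ has
  ... | inj₂ none = inj₂ λ z⊑ eq full → none z⊑ (eq , full)

  NoFull-⊑ : ∀ {F y y′ h} → y′ ⊑ y → NoFull F y h → NoFull F y′ h
  NoFull-⊑ y′⊑y none z⊑ = none (⊑-trans z⊑ y′⊑y)

  NoFull-suc : ∀ {F y h} → NoFull F y h → NoFull F y (suc h)
  NoFull-suc none {suc j , n} z⊑ refl full = none (⊑-trans (child₀⊑ j n) z⊑) refl (proj₂ (proj₁ full))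

  NoFull-+ : ∀ {F y h} d → NoFull F y h → NoFull F y (d + h)
  NoFull-+ {F} zero none = none
  NoFull-+ {F} (suc d) none = NoFull-suc {F} (NoFull-+ {F} d none)

  -- Each of the 2^t subtrees of level m is contained in neither F nor G, so F meets it without containing it.
  covered⇒gaps : ∀ {F G H} t m n → (∀ {e} → e ∈ H → e ∈ F ⊎ e ∈ G) →
    NoFull F (t + m , n) m → NoFull G (t + m , n) m → Full H (t + m , n) → 2 ^ t ≤ gaps F (t + m , n)
  covered⇒gaps {F} {G} {H} zero m n cover noF noG full with any-below? (_∈? vertexSet F) m n
  ... | inj₁ (v , v⊑ , v∈) = touched⇒gap F v⊑ v∈ (noF here refl)
  ... | inj₂ untouched     = ⊥-elim (noG here refl (untouched⇒Full {F} {G} {H} m n cover untouched full))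
  covered⇒gaps {F} {G} {H} (suc t) m n cover noF noG ((_ , f₀) , (_ , f₁)) = subst₂ _≤_
    (cong (2 ^ t +_) (sym (+-identityʳ _))) (sym (gaps-split F (t + m) n))
    (≤-trans (+-mono-≤
      (covered⇒gaps {F} {G} {H} t m (2 * n) cover (NoFull-⊑ {F} c₀⊑ noF) (NoFull-⊑ {G} c₀⊑ noG) f₀)
      (covered⇒gaps {F} {G} {H} t m (suc (2 * n)) cover (NoFull-⊑ {F} c₁⊑ noF) (NoFull-⊑ {G} c₁⊑ noG) f₁))
      (m≤n+m _ (gap F (suc (t + m) , n))))
    where
    c₀⊑ = child₀⊑ (t + m) n
    c₁⊑ = child₁⊑ (t + m) n

  -- If `F` meets all `2 ^ t` disjoint subtrees of level `m`, it contains none of them, and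
  -- `touched⇒gap` finds a missing edge in each.
  untouched-subtree : ∀ F t m n → NoFull F (t + m , n) m →
    (∃[ w ] w ⊑ (t + m , n) × level w ≡ m × Untouched (vertexSet F) w) ⊎ 2 ^ t ≤ gaps F (t + m , n)
  untouched-subtree F zero m n noF with any-below? (_∈? vertexSet F) m n
  ... | inj₁ (v , v⊑ , v∈) = inj₂ (touched⇒gap F v⊑ v∈ (noF here refl))
  ... | inj₂ untouched     = inj₁ (_ , here , refl , untouched)
  untouched-subtree F (suc t) m n noF
    with untouched-subtree F t m (2 * n) (NoFull-⊑ {F} (child₀⊑ (t + m) n) noF)
       | untouched-subtree F t m (suc (2 * n)) (NoFull-⊑ {F} (child₁⊑ (t + m) n) noF)
  ... | inj₁ (w , w⊑ , found) | _ = inj₁ (w , ⊑-trans w⊑ (child₀⊑ (t + m) n) , found)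
  ... | inj₂ _ | inj₁ (w , w⊑ , found) = inj₁ (w , ⊑-trans w⊑ (child₁⊑ (t + m) n) , found)
  ... | inj₂ g₀ | inj₂ g₁ = inj₂ (subst₂ _≤_
    (cong (2 ^ t +_) (sym (+-identityʳ _))) (sym (gaps-split F (t + m) n))
    (≤-trans (+-mono-≤ g₀ g₁) (m≤n+m _ (gap F (suc (t + m) , n)))))

  -- Either the sibling edge is missing at the parent, or `F` enters the sibling subtree. That one
  -- is incomplete: otherwise the parent's tree would be complete, or level `i` is excluded
  -- outright.
  sibling-gap₀ : ∀ {F w} i p {c} → (suc i , p) ⊑ w → child₀ i p ∈ F → Full F (child₀ i p) ⊎ NoFull F w i →
    NoFull F w (suc i) → c ≤ gaps F (child₀ i p) → suc c ≤ gaps F (suc i , p)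
  sibling-gap₀ {F} i p {c} parent⊑ e₀ full⊎none none c≤ = subst (suc c ≤_) (sym (gaps-split F i p)) bound
    where
    bound : suc c ≤ gap F (suc i , p) + (gaps F (child₀ i p) + gaps F (child₁ i p))
    bound with child₁ i p ∈? F
    ... | no e₁∉ = +-mono-≤
      (gap-missing {F} (subst (_∈ vertexSet F) (parent-child₀ i p) (upper∈V e₀)) (below₁ e₁∉)) (≤-trans c≤ (m≤m+n _ _))
    ... | yes e₁ = ≤-trans (≤-trans (≤-reflexive (sym (+-comm _ 1)))
      (+-mono-≤ c≤ (notFull⇒gap F i (suc (2 * p)) (lower∈V e₁) sibling-not-full))) (m≤n+m _ (gap F (suc i , p)))
      where
      sibling-not-full : ¬ Full F (child₁ i p)
      sibling-not-full f₁ = [ (λ f₀ → none parent⊑ refl ((e₀ , f₀) , (e₁ , f₁)))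
                            , (λ none₁ → none₁ (⊑-trans (child₁⊑ i p) parent⊑) refl f₁) ]′ full⊎none

  sibling-gap₁ : ∀ {F w} i p {c} → (suc i , p) ⊑ w → child₁ i p ∈ F → Full F (child₁ i p) ⊎ NoFull F w i →
    NoFull F w (suc i) → c ≤ gaps F (child₁ i p) → suc c ≤ gaps F (suc i , p)
  sibling-gap₁ {F} i p {c} parent⊑ e₁ full⊎none none c≤ = subst (suc c ≤_) (sym (gaps-split F i p)) bound
    where
    bound : suc c ≤ gap F (suc i , p) + (gaps F (child₀ i p) + gaps F (child₁ i p))
    bound with child₀ i p ∈? F
    ... | no e₀∉ = +-mono-≤
      (gap-missing {F} (subst (_∈ vertexSet F) (parent-child₁ i p) (upper∈V e₁)) (below₀ e₀∉)) (≤-trans c≤ (m≤n+m _ _))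
    ... | yes e₀ = ≤-trans
      (+-mono-≤ (notFull⇒gap F i (2 * p) (lower∈V e₀) sibling-not-full) c≤) (m≤n+m _ (gap F (suc i , p)))
      where
      sibling-not-full : ¬ Full F (child₀ i p)
      sibling-not-full f₀ = [ (λ f₁ → none parent⊑ refl ((e₀ , f₀) , (e₁ , f₁)))
                            , (λ none₀ → none₀ (⊑-trans (child₀⊑ i p) parent⊑) refl f₀) ]′ full⊎none

  -- Above a maximal full subtree, every step upwards along edges of F passes a sibling subtree that
  -- contributes a gap of its own.
  climb : ∀ F {v w} c → v ⊑ w → c ≤ gaps F v → Full F v ⊎ NoFull F w (level v) → NoFull F w (suc (level v)) →
    (∃[ u ] v ⊑ u × u ⊑ w × u ∉ F) ⊎ c + level w ≤ gaps F w + level v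
  climb F c here c≤ _ _ = inj₂ (+-monoˡ-≤ _ c≤)
  climb F {v} {w} c (up p) c≤ full⊎none none with v ∈? F
  ... | no v∉ = inj₁ (v , here , up p , v∉)
  -- Only the starting vertex may be complete; from its parent on, `none` excludes the current
  -- level.
  ... | yes v∈ with climb F (suc c) p (step (childView (level v) (proj₂ v))) (inj₂ none) (NoFull-suc {F} none)
    where
    i = level v
    n = proj₂ v / 2
    step : v ≡ child₀ i n ⊎ v ≡ child₁ i n → suc c ≤ gaps F (suc i , n)
    step (inj₁ eq) = sibling-gap₀ {F} {w} i n p (subst (_∈ F) eq v∈)
      (subst (λ u → Full F u ⊎ NoFull F w i) eq full⊎none) none (subst (λ u → c ≤ gaps F u) eq c≤)
    step (inj₂ eq) = sibling-gap₁ {F} {w} i n p (subst (_∈ F) eq v∈)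
      (subst (λ u → Full F u ⊎ NoFull F w i) eq full⊎none) none (subst (λ u → c ≤ gaps F u) eq c≤)
  ...   | inj₁ (u , v⊑u , u⊑w , u∉) = inj₁ (u , up v⊑u , u⊑w , u∉)
  ...   | inj₂ bound = inj₂ (s≤s⁻¹ (subst (suc c + level w ≤_) (+-suc _ _) bound))

  -- Components below a missing edge.

  -- The edge `u` is the only one leaving T_u, so without it the search for a component cannot get
  -- out.
  reach-closed : ∀ {F u} → u ∉ F → ∀ k {S} → All (_⊑ u) S → All (_⊑ u) (reach k F S)
  reach-closed u∉ zero    S⊑ = S⊑
  reach-closed {F} {u} u∉ (suc k) {S} S⊑ = reach-closed u∉ k (All.tabulate grow⊑)
    where
    stays : ∀ {e v} → e ∈ F → e ⊑ u → v ∈ ends e → v ⊑ u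
    stays e∈ e⊑         (here refl)         = e⊑
    stays e∈ here       (there (here refl)) = ⊥-elim (u∉ e∈)
    stays e∈ (up par⊑u) (there (here refl)) = par⊑u
    meets? : Edge → Bool
    meets? e = any (_∈ᵇ S) (ends e)
    grow⊑ : ∀ {v} → v ∈ grow F S → v ⊑ u
    grow⊑ v∈ with ∈-++⁻ S v∈
    ... | inj₁ v∈S = All.lookup S⊑ v∈S
    ... | inj₂ v∈new with find (∈-concatMap⁻ ends {filterᵇ meets? F} v∈new)
    ...   | e , e∈ , v∈e with ∈-filter⁻ (T? ∘ meets?) {xs = F} e∈
    ...     | e∈F , meets with find (any⁻ (_∈ᵇ S) (ends e) meets)
    ...       | x , here refl , x∈ = stays e∈F (All.lookup S⊑ (∈ᵇ⇒∈ x S x∈)) v∈e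
    ...       | x , there (here refl) , x∈ = stays e∈F (up (All.lookup S⊑ (∈ᵇ⇒∈ x S x∈))) v∈e

  below-cut-kept : ∀ {F S u e} → u ∉ F → Untouched S u → e ∈ F → e ⊑ u → T (keptᵇ F S e)
  below-cut-kept u∉ _ e∈ here = ⊥-elim (u∉ e∈)
  below-cut-kept {F} {S} {u} {e} u∉ untouched e∈ (up par⊑u) = all⁻ _ (All.map not-in-S
    (reach-closed u∉ (length F) (up par⊑u ∷ par⊑u ∷ [])))
    where
    not-in-S : ∀ {v} → v ⊑ u → T (not (v ∈ᵇ S))
    not-in-S {v} v⊑ with v ∈ᵇ S in eq
    ... | true  = ⊥-elim (untouched v⊑ (∈ᵇ⇒∈ v S (subst T (sym eq) _)))
    ... | false = _

  Full-⊖ : ∀ {F S u} k n → (k , n) ⊑ u → u ∉ F → Untouched S u → Full F (k , n) → Full (F ⊖G S) (k , n)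
  Full-⊖ {F} {S} k n z⊑u u∉ untouched = Full-mono k n λ e⊑z e∈ →
    ∈-filter⁺ (λ e → T? (keptᵇ F S e)) e∈ (below-cut-kept u∉ untouched e∈ (⊑-trans e⊑z z⊑u))

  Full-parent⇒∈ : ∀ {F} v → Full F (parent v) → v ∈ F
  Full-parent⇒∈ {F} (i , m) ((e₀ , _) , (e₁ , _)) with childView i m
  ... | inj₁ eq = subst (_∈ F) (sym eq) e₀
  ... | inj₂ eq = subst (_∈ F) (sym eq) e₁

  Full⇒root∈V : ∀ {F j n} → Full F (suc j , n) → (suc j , n) ∈ vertexSet F
  Full⇒root∈V {F} {j} {n} ((e₀ , _) , _) = subst (_∈ vertexSet F) (parent-child₀ j n) (upper∈V e₀)

  -- `F` meets the tree of `parent u` at `v`, but does not contain it because the edge `u` is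
  -- missing.
  cut-∂ : ∀ {F u} v → 1 ≤ level v → v ⊑ u → u ∉ F → Full F v → 1 ≤ ∂ F
  cut-∂ {F} {u} (suc j , n) _ v⊑u u∉ full = ≤-trans
    (touched⇒gap F (⊑-trans v⊑u (up here)) (Full⇒root∈V {F} {j} {n} full) (u∉ ∘ Full-parent⇒∈ {F} u))
    (gaps≤∂ F (parent u))

  graph-⊖ : ∀ A S → graph (A ⊖ S) ≡ graph A ⊖G S
  graph-⊖ A S = graph-relabel A
    where
    F = graph A
    graph-relabel : ∀ B → graph (relabel F S B) ≡ filterᵇ (keptᵇ F S) (graph B)
    graph-relabel (leaf nothing)  = refl
    graph-relabel (leaf (just e)) with keptᵇ F S e
    ... | true  = refl
    ... | false = refl
    graph-relabel (node B C) = trans (cong₂ _++_ (graph-relabel B) (graph-relabel C))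
      (sym (filter-++ (λ e → T? (keptᵇ F S e)) (graph B) (graph C)))

  -- Descents in a join-tree.

  infix 4 _≺_ _≼_
  data _≺_ (D : JoinTree) : JoinTree → Set

  _≼_ : JoinTree → JoinTree → Set
  D ≼ A = D ≡ A ⊎ D ≺ A

  data _≺_ D where
    left  : ∀ {B C} → D ≼ B → D ≺ node B C
    right : ∀ {B C} → D ≼ C → D ≺ node B C

  -- Where a descent aiming at level `h` stops: the best complete subtree of `E` below `y` lies
  -- `t + 1` levels lower, and `E` has paid for this with `2 ^ t` missing edges.
  record Descent (A : JoinTree) (y : Vertex) (h : ℕ) : Set where
    constructor descended
    field
      {E}     : JoinTree
      E≺A     : E ≺ A
      {z}     : Vertex
      z⊑y     : z ⊑ y
      full    : Full (graph E) z
      maximal : NoFull (graph E) y (suc (level z))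
      t       : ℕ
      drop    : t + suc (level z) ≡ h
      2^t≤∂   : 2 ^ t ≤ ∂ (graph E)

  leftmost-below : ∀ t m n → ∃[ i ] (m , i) ⊑ (t + m , n)
  leftmost-below zero    m n = n , here
  leftmost-below (suc t) m n with leftmost-below t m (2 * n)
  ... | i , i⊑ = i , ⊑-trans i⊑ (child₀⊑ (t + m) n)

  -- Searches downwards from `h`; it succeeds at level 0 at the latest, where every tree is
  -- complete.
  highest : ∀ F G y h → NoFull F y h → NoFull G y h →
    ∃[ g ] ∃[ t ] t + suc g ≡ h × NoFull F y (suc g) × NoFull G y (suc g) × (HasFull F y g ⊎ HasFull G y g)
  highest F G (k , n) zero noF _ = ⊥-elim (noF (subst (λ i → (0 , proj₁ leftmost) ⊑ (i , n)) (+-identityʳ k) (proj₂ leftmost)) refl _)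
    where leftmost = leftmost-below k 0 n
  highest F G y (suc h) noF noG with hasFull? F y h | hasFull? G y h
  ... | inj₁ has | _ = h , 0 , refl , noF , noG , inj₁ has
  ... | _ | inj₁ has = h , 0 , refl , noF , noG , inj₂ has
  ... | inj₂ noF′ | inj₂ noG′ with highest F G y h noF′ noG′
  ...   | g , t , eq , rest = g , suc t , cong suc eq , rest

  Full-leaf : ∀ a j n → ¬ Full (graph (leaf a)) (suc j , n)
  Full-leaf (just _) j n ((here refl , _) , (here eq , _)) = even≢odd n n (sym (cong proj₂ eq))

  -- Recurses into a child as long as one has a complete subtree of level `h + 1` below `y`. When
  -- neither does, the child reaching the larger level `g` is taken: the two cover such a subtree
  -- together and both lack level `g + 1`, so `covered⇒gaps` applies.
  descent : ∀ A y h → HasFull (graph A) y (suc h) → Descent A y (suc h)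
  descent (leaf a) y h ((_ , n) , _ , refl , full) = ⊥-elim (Full-leaf a h n full)
  descent (node B C) y h has with hasFull? (graph B) y (suc h) | hasFull? (graph C) y (suc h)
  ... | inj₁ hasB | _ = record { Descent (descent B y h hasB) ; E≺A = left (inj₂ (Descent.E≺A (descent B y h hasB))) }
  ... | _ | inj₁ hasC = record { Descent (descent C y h hasC) ; E≺A = right (inj₂ (Descent.E≺A (descent C y h hasC))) }
  ... | inj₂ noB | inj₂ noC with highest (graph B) (graph C) y (suc h) noB noC | has
  ...   | g , t , eq , noB′ , noC′ , found | (k , n) , z⊑y , eq′ , full with trans eq′ (sym eq)
  ...     | refl with found
  ...       | inj₁ (z , z⊑ , refl , fullB) = descended (left (inj₁ refl)) z⊑ fullB noB′ t eq
    (≤-trans (covered⇒gaps {graph B} {graph C} t _ n (∈-++⁻ (graph B))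
      (NoFull-⊑ {graph B} z⊑y noB′) (NoFull-⊑ {graph C} z⊑y noC′) full) (gaps≤∂ (graph B) (k , n)))
  ...       | inj₂ (z , z⊑ , refl , fullC) = descended (right (inj₁ refl)) z⊑ fullC noC′ t eq
    (≤-trans (covered⇒gaps {graph C} {graph B} t _ n ([ inj₂ , inj₁ ]′ ∘ ∈-++⁻ (graph B))
      (NoFull-⊑ {graph C} z⊑y noC′) (NoFull-⊑ {graph B} z⊑y noB′) full) (gaps≤∂ (graph C) (k , n)))

  Full⇒HasFull : ∀ F t m n {k} → k ≡ t + m → Full F (k , n) → HasFull F (k , n) m
  Full⇒HasFull F t m n refl full with leftmost-below t m n
  ... | i , i⊑ = _ , i⊑ , refl , Full-⊑ {F} i⊑ full

  -- `F` meets the tree of the parent, one level higher, and cannot contain it by maximality of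
  -- `λG`.
  Full-λ⇒∂ : ∀ F {j n} → suc j ≡ λG F → Full F (suc j , n) → 1 ≤ ∂ F
  Full-λ⇒∂ F {j} {n} eq full = ≤-trans
    (touched⇒gap F {suc j , n} (up here) (Full⇒root∈V {F} {j} {n} full)
      λ full′ → 1+n≰n (subst (suc (suc j) ≤_) (sym eq) (Full⇒level≤λ F (parent (suc j , n)) full′)))
    (gaps≤∂ F (parent (suc j , n)))

  -- A smallest counterexample is impossible.

  λ′ ∂′ : JoinTree → ℕ
  λ′ D = λG (graph D)
  ∂′ D = ∂ (graph D)

  module _ (A : JoinTree) (k a : ℕ) (10a<k+4a : 10 * a < k + 4 * a)
      (F1 : ∀ {D} → D ≺ A → λ′ D + 4 * ∂′ D < k + 4 * a)
      (F2 : ∀ {D E} → D ≺ A → E ≺ A →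
        λ′ D + 4 * ∂′ D + (λ′ (E ⊖ V D) + 4 * ∂′ (E ⊖ V D)) + 10 * a < 2 * (k + 4 * a)) where

    module _ {r ℓ} (1≤a : 1 ≤ a) (4r≤ : 4 * r ≤ a + 12)
        (≤3ℓ : 4 * a + r ≤ 3 * ℓ + 3) (3ℓ≤ : 3 * ℓ + 1 ≤ 4 * a + r) where

      -- The second descent, inside T_w, followed by a climb in `E` from `z` towards `w`: it either
      -- arrives or stops at a missing edge `u`.
      untouched-contradiction : ∀ {D w s d g₁ t₁ h} → D ≺ A →
        g₁ ≤ λ′ D → t₁ < ∂′ D → 3 * ∂′ D + 1 ≤ 4 * a + r → k ≡ r + (t₁ + suc g₁) →
        r ≡ d + s → s ≤ ∂′ D → level w ≡ ℓ + suc h → k ≡ s + level w →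
        Untouched (V D) w → Full (graph A) w → ⊥
      untouched-contradiction {D} {w} {s} {d} {g₁} {t₁} {h} D≺A g₁≤ t₁< 3β≤ k≡₁ r≡ s≤β w≡ k≡ untouched full =
        [ cut , climbed ]′ (climb (graph E) 0 z⊑y z≤n (inj₁ fullE) maximal)
        where
        open Descent (descent A w h (Full⇒HasFull (graph A) ℓ (suc h) (proj₂ w) w≡ full)) renaming (full to fullE)
        g₂ = level z
        w≡′ : level w ≡ ℓ + (t + suc g₂)
        w≡′ = trans w≡ (cong (ℓ +_) (sym drop))
        k≡₂ : k ≡ s + (ℓ + (t + suc g₂))
        k≡₂ = trans k≡ (cong (s +_) w≡′)
        -- Used with `b = ∂′ E` for the completed climb and with `b = 2 ^ t` for the cut.
        F1-E : ∀ {b} → b ≤ ∂′ E → g₂ + 4 * b < k + 4 * a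
        F1-E b≤ = ≤-<-trans (+-mono-≤ (Full⇒level≤λ (graph E) z fullE) (scale 4 b≤)) (F1 E≺A)

        climbed : level w ≤ gaps (graph E) w + g₂ → ⊥
        climbed bound = climbed-too-far a k r s d ℓ g₂ t (∂′ E) ≤3ℓ r≡ k≡₂ (F1-E ≤-refl)
          (subst (_≤ ∂′ E + g₂) w≡′ (≤-trans bound (+-monoˡ-≤ g₂ (gaps≤∂ (graph E) w))))

        cut : ∃[ u ] z ⊑ u × u ⊑ w × u ∉ graph E → ⊥
        cut (u , z⊑u , u⊑w , u∉) = balance-contradiction a k r s d (∂′ D) ℓ g₁ t₁ g₂ t (2 ^ t)
          4r≤ 3ℓ≤ r≡ s≤β t₁< k≡₁ k≡₂ (F1-E 2^t≤∂) (8n≤2^n+16 t)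
          (≤-<-trans (+-monoˡ-≤ (10 * a) (+-mono-≤ (+-monoˡ-≤ (4 * ∂′ D) g₁≤) (+-mono-≤ g₂≤ (scale 4 1≤∂))))
            (F2 D≺A E≺A))
          where
          G = graph E ⊖G V D
          fullG : Full G z
          fullG = Full-⊖ {graph E} g₂ (proj₂ z) z⊑u u∉ (λ v⊑ → untouched (⊑-trans v⊑ u⊑w)) fullE
          g₂≤ : g₂ ≤ λ′ (E ⊖ V D)
          g₂≤ = subst (λ F → g₂ ≤ λG F) (sym (graph-⊖ E (V D))) (Full⇒level≤λ G z fullG)
          -- The cut below `u` leaves a missing edge in `E ⊖ V D`, the source of the summand 4 in
          -- `balance-contradiction`.
          1≤∂ : 1 ≤ ∂′ (E ⊖ V D)
          1≤∂ = subst (λ F → 1 ≤ ∂ F) (sym (graph-⊖ E (V D))) (cut-∂ {G} z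
            (level-positive a k r s (∂′ D) ℓ g₂ t (2 ^ t) 1≤a 10a<k+4a 4r≤ 3ℓ≤ s≤β 3β≤ k≡₂ (F1-E 2^t≤∂)
              (4n≤2^n+4 t))
            z⊑u (λ u∈ → u∉ (proj₁ (∈-filter⁻ (λ e → T? (keptᵇ (graph E) (V D) e)) u∈))) fullG)

      -- The first descent, aiming at level `k - r`. Its `E` becomes the `D` of
      -- `untouched-contradiction`.
      full-contradiction : ∀ {n o} → 4 * a + r ≤ 3 * 2 ^ r → k ≡ r + (ℓ + suc o) → Full (graph A) (k , n) → ⊥
      full-contradiction {n} {o} ≤2^r k≡ full = at-scale (∃-s a r (∂′ E) 3β≤ ≤2^r)
        where
        open Descent (descent A (k , n) (ℓ + o) (Full⇒HasFull (graph A) r (suc (ℓ + o)) n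
          (trans k≡ (cong (r +_) (+-suc ℓ o))) full)) renaming (full to fullE)
        g₁≤ : level z ≤ λ′ E
        g₁≤ = Full⇒level≤λ (graph E) z fullE
        k≡₁ : k ≡ r + (t + suc (level z))
        k≡₁ = trans k≡ (cong (r +_) (trans (+-suc ℓ o) (sym drop)))
        t<∂ : t < ∂′ E
        t<∂ = <-≤-trans (n<2^n t) 2^t≤∂
        3β≤ : 3 * ∂′ E + 1 ≤ 4 * a + r
        3β≤ = ∂-bound a k r (level z) t (∂′ E) (≤-<-trans (+-monoˡ-≤ (4 * ∂′ E) g₁≤) (F1 E≺A)) k≡₁ t<∂

        at-scale : ∃[ s ] ∃[ d ] r ≡ d + s × s ≤ ∂′ E × ∂′ E < 2 ^ s → ⊥
        at-scale (s , d , r≡ , s≤β , β<2^s) =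
          [ (λ (w , w⊑ , w≡ , untouched) → untouched-contradiction {h = d + o} E≺A g₁≤ t<∂ 3β≤ k≡₁ r≡ s≤β
              (trans w≡ m≡′) (trans k≡s+m (cong (s +_) (sym w≡))) untouched
              (Full-⊑ {graph A} (subst (λ i → w ⊑ (i , n)) (sym k≡s+m) w⊑) full))
          , (λ 2^s≤ → <⇒≱ β<2^s (≤-trans 2^s≤ (gaps≤∂ (graph E) (s + m , n)))) ]′
          (untouched-subtree (graph E) s m n
            -- From the level above `z`, `t` steps up lead to level `k - r` and `d` more to
            -- `m = k - s`.
            (NoFull-+ {graph E} d (subst₂ (λ i → NoFull (graph E) (i , n)) k≡s+m (trans drop (sym (+-suc ℓ o)))
              (NoFull-+ {graph E} t maximal))))
          where
          m = d + (ℓ + suc o)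
          k≡s+m : k ≡ s + m
          k≡s+m = trans k≡ (trans (cong (_+ (ℓ + suc o)) (trans r≡ (+-comm d s))) (+-assoc s d _))
          m≡′ : m ≡ ℓ + suc (d + o)
          m≡′ = exchange d ℓ o
            where
            exchange : ∀ d ℓ o → d + (ℓ + suc o) ≡ ℓ + suc (d + o)
            exchange = solve-∀

  no-counterexample : ∀ A k a → k ≡ λ′ A → a ≡ ∂′ A → 10 * a < k + 4 * a →
    (∀ {D} → D ≺ A → λ′ D + 4 * ∂′ D < k + 4 * a) →
    (∀ {D E} → D ≺ A → E ≺ A →
      λ′ D + 4 * ∂′ D + (λ′ (E ⊖ V D) + 4 * ∂′ (E ⊖ V D)) + 10 * a < 2 * (k + 4 * a)) →
    ⊥
  -- For `k = 0` the (‡) bound reads `10a < 4a`.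
  no-counterexample A zero a _ _ 10a<k+4a _ _ = n≮n (10 * a) (<-≤-trans 10a<k+4a (*-monoˡ-≤ a (m≤m+n 4 6)))
  no-counterexample A k@(suc j) a k≡λ a≡∂ 10a<k+4a F1 F2 = go-r (λ-attained (graph A)) (∃-r a)
    where
    module _ {n} (full : Full (graph A) (k , n)) {r} (4r≤ : 4 * r ≤ a + 12) (≤2^r : 4 * a + r ≤ 3 * 2 ^ r) where
      1≤a : 1 ≤ a
      1≤a = subst (1 ≤_) (sym a≡∂) (Full-λ⇒∂ (graph A) {j} {n} k≡λ full)
      go-ℓ : ∃[ ℓ ] 4 * a + r ≤ 3 * ℓ + 3 × 3 * ℓ + 1 ≤ 4 * a + r → ⊥
      go-ℓ (ℓ , ≤3ℓ , 3ℓ≤) = go (m≤n⇒∃[o]m+o≡n (scales<k a k r ℓ 1≤a 10a<k+4a 4r≤ 3ℓ≤))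
        where
        go : ∃[ o ] suc (r + ℓ) + o ≡ k → ⊥
        go (o , k≡) =
          full-contradiction A k a 10a<k+4a F1 F2 1≤a 4r≤ ≤3ℓ 3ℓ≤ {n} ≤2^r (trans (sym k≡) (exchange r ℓ o)) full
          where
          exchange : ∀ r ℓ o → suc (r + ℓ) + o ≡ r + (ℓ + suc o)
          exchange = solve-∀
    go-r : ∃[ x ] level x ≡ λG (graph A) × Full (graph A) x →
      ∃[ r ] 4 * r ≤ a + 12 × 4 * a + r ≤ 3 * 2 ^ r × 3 ≤ r → ⊥
    go-r ((l , n) , l≡ , full) (r , 4r≤ , ≤2^r , 3≤r) =
      go-ℓ {n} (subst (λ i → Full (graph A) (i , n)) (trans l≡ (sym k≡λ)) full) 4r≤ ≤2^r
        (∃-ℓ (4 * a + r) (≤-trans (s≤s z≤n) (≤-trans 3≤r (m≤n+m r (4 * a)))))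

open Combinatorics
open import Data.Integer using (+_)
import Data.Integer as ℤ
import Data.Integer.Properties as ℤ
open import Data.Rational using (_≤_; _+_; _*_; _/_; ℚ; 0ℚ; ½; _-_; _≤?_; toℚᵘ)
open import Data.Rational.Properties
open import Data.Rational.Solver using (module +-*-Solver)
import Data.Rational.Unnormalised as ℚᵘ
open ℚᵘ using (mkℚᵘ; *≡*; *≤*)
import Data.Rational.Unnormalised.Properties as ℚᵘ

-- Rational values as multiples of 1/30.

toℚᵘ-fromℕ : ∀ n → toℚᵘ (fromℕ n) ℚᵘ.≃ mkℚᵘ (+ n) 0
toℚᵘ-fromℕ n = toℚᵘ-fromℚᵘ (mkℚᵘ (+ n) 0)

fromℕ-+ : ∀ m n → fromℕ (m ℕ.+ n) ≡ fromℕ m + fromℕ n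
fromℕ-+ m n = toℚᵘ-injective (begin
  toℚᵘ (fromℕ (m ℕ.+ n))               ≈⟨ toℚᵘ-fromℕ (m ℕ.+ n) ⟩
  mkℚᵘ (+ (m ℕ.+ n)) 0
    ≈⟨ *≡* (cong (ℤ._* + 1) (sym (cong₂ ℤ._+_ (ℤ.*-identityʳ (+ m)) (ℤ.*-identityʳ (+ n))))) ⟩
  mkℚᵘ (+ m) 0 ℚᵘ.+ mkℚᵘ (+ n) 0        ≈⟨ ℚᵘ.+-cong (toℚᵘ-fromℕ m) (toℚᵘ-fromℕ n) ⟨
  toℚᵘ (fromℕ m) ℚᵘ.+ toℚᵘ (fromℕ n)    ≈⟨ toℚᵘ-homo-+ (fromℕ m) (fromℕ n) ⟨
  toℚᵘ (fromℕ m + fromℕ n)              ∎)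
  where open ℚᵘ.≃-Reasoning

fromℕ-* : ∀ m n → fromℕ (m ℕ.* n) ≡ fromℕ m * fromℕ n
fromℕ-* m n = toℚᵘ-injective (begin
  toℚᵘ (fromℕ (m ℕ.* n))               ≈⟨ toℚᵘ-fromℕ (m ℕ.* n) ⟩
  mkℚᵘ (+ (m ℕ.* n)) 0                  ≈⟨ *≡* (cong (ℤ._* + 1) (ℤ.pos-* m n)) ⟩
  mkℚᵘ (+ m) 0 ℚᵘ.* mkℚᵘ (+ n) 0        ≈⟨ ℚᵘ.*-cong (toℚᵘ-fromℕ m) (toℚᵘ-fromℕ n) ⟨
  toℚᵘ (fromℕ m) ℚᵘ.* toℚᵘ (fromℕ n)    ≈⟨ toℚᵘ-homo-* (fromℕ m) (fromℕ n) ⟨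
  toℚᵘ (fromℕ m * fromℕ n)              ∎)
  where open ℚᵘ.≃-Reasoning

fromℕ-mono : ∀ {m n} → m ℕ.≤ n → fromℕ m ≤ fromℕ n
fromℕ-mono {m} {n} m≤n = toℚᵘ-cancel-≤ (ℚᵘ.≤-respˡ-≃ (ℚᵘ.≃-sym (toℚᵘ-fromℕ m))
  (ℚᵘ.≤-respʳ-≃ (ℚᵘ.≃-sym (toℚᵘ-fromℕ n)) (*≤* (ℤ.*-monoʳ-≤-nonNeg (+ 1) (ℤ.+≤+ m≤n)))))

-- In this unit `Δθ F` is `10 ∂ F` and the claimed bound is `λG F + 4 ∂ F`, so the contradiction can
-- be derived in ℕ.
thirtieths : ℕ → ℚ
thirtieths n = (+ 1 / 30) * fromℕ n

thirtieths-+ : ∀ m n → thirtieths (m ℕ.+ n) ≡ thirtieths m + thirtieths n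
thirtieths-+ m n = trans (cong ((+ 1 / 30) *_) (fromℕ-+ m n)) (*-distribˡ-+ (+ 1 / 30) (fromℕ m) (fromℕ n))

thirtieths-mono : ∀ {m n} → m ℕ.≤ n → thirtieths m ≤ thirtieths n
thirtieths-mono m≤n = *-monoˡ-≤-nonNeg (+ 1 / 30) (fromℕ-mono m≤n)

thirtieths-* : ∀ c n → thirtieths (c ℕ.* n) ≡ (+ 1 / 30) * fromℕ c * fromℕ n
thirtieths-* c n = trans (cong ((+ 1 / 30) *_) (fromℕ-* c n)) (sym (*-assoc (+ 1 / 30) (fromℕ c) (fromℕ n)))

½-thirtieths : ∀ n → ½ * thirtieths (2 ℕ.* n) ≡ thirtieths n
½-thirtieths n = trans (cong (½ *_) (thirtieths-* 2 n)) (sym (*-assoc ½ ((+ 1 / 30) * fromℕ 2) (fromℕ n)))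

sum-θ : ∀ es → sumℚ (map θ es) ≡ (+ 1 / 3) * fromℕ (∑ es (λ e → weight e ℕ.+ 1))
sum-θ [] = refl
sum-θ (e ∷ es) = trans (cong₂ _+_ (θ-weight e) (sum-θ es))
  (trans (sym (*-distribˡ-+ (+ 1 / 3) (fromℕ (weight e ℕ.+ 1)) _)) (cong ((+ 1 / 3) *_) (sym (fromℕ-+ (weight e ℕ.+ 1) _))))
  where
  θ-weight : ∀ e → θ e ≡ (+ 1 / 3) * fromℕ (weight e ℕ.+ 1)
  θ-weight (zero  , _) = refl
  θ-weight (suc _ , _) = refl

Δ-∂ : ∀ F → Δθ F ≡ (+ 1 / 3) * fromℕ (∂ F)
Δ-∂ F = begin
  fromℕ v - sumℚ (map θ (edgeSet F))                      ≡⟨ cong₂ _-_ v≡ (sum-θ (edgeSet F)) ⟩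
  ⅓ * (fromℕ s + fromℕ (∂ F)) - ⅓ * fromℕ s               ≡⟨ cancel ⅓ (fromℕ s) (fromℕ (∂ F)) ⟩
  ⅓ * fromℕ (∂ F)                                         ∎
  where
  open ≡-Reasoning
  ⅓ = + 1 / 3
  v = length (vertexSet F)
  s = ∑ (edgeSet F) (λ e → weight e ℕ.+ 1)
  v≡ : fromℕ v ≡ ⅓ * (fromℕ s + fromℕ (∂ F))
  v≡ = begin
    fromℕ v                          ≡⟨ sym (*-identityʳ (fromℕ v)) ⟩
    fromℕ v * (fromℕ 3 * ⅓)          ≡⟨ sym (*-assoc (fromℕ v) (fromℕ 3) ⅓) ⟩
    fromℕ v * fromℕ 3 * ⅓            ≡⟨ *-comm (fromℕ v * fromℕ 3) ⅓ ⟩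
    ⅓ * (fromℕ v * fromℕ 3)
      ≡⟨ cong (⅓ *_) (trans (sym (fromℕ-* v 3)) (trans (cong fromℕ (∂-balance F)) (fromℕ-+ s (∂ F)))) ⟩
    ⅓ * (fromℕ s + fromℕ (∂ F))      ∎
  cancel : ∀ c x y → c * (x + y) - c * x ≡ c * y
  cancel = +-*-Solver.solve 3 (λ c x y → c :* (x :+ y) :- c :* x := c :* y) refl
    where open +-*-Solver

Δ-thirtieths : ∀ F → Δθ F ≡ thirtieths (10 ℕ.* ∂ F)
Δ-thirtieths F = trans (Δ-∂ F) (sym (thirtieths-* 10 (∂ F)))

bound-thirtieths : ∀ F → (+ 1 / 30) * fromℕ (λG F) + (+ 2 / 5) * Δθ F ≡ thirtieths (λG F ℕ.+ 4 ℕ.* ∂ F)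
bound-thirtieths F = trans (cong (λ x → thirtieths (λG F) + x) (trans (cong ((+ 2 / 5) *_) (Δ-∂ F))
  (trans (sym (*-assoc (+ 2 / 5) (+ 1 / 3) (fromℕ (∂ F)))) (sym (thirtieths-* 4 (∂ F))))))
  (sym (thirtieths-+ (λG F) (4 ℕ.* ∂ F)))

Δ≥0 : ∀ F → 0ℚ ≤ Δθ F
Δ≥0 F = subst (0ℚ ≤_) (sym (Δ-thirtieths F)) (thirtieths-mono {0} {10 ℕ.* ∂ F} z≤n)

-- Consequences of (†) and (‡).

∈⇒≤maxℚ : ∀ {x xs} → x ∈ xs → x ≤ maxℚ xs
∈⇒≤maxℚ {xs = x ∷ xs} (here refl) = p≤p⊔q x (maxℚ xs)
∈⇒≤maxℚ {xs = y ∷ xs} (there x∈)  = ≤-trans (∈⇒≤maxℚ x∈) (p≤q⊔p y (maxℚ xs))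

maxℚ-mono : ∀ {xs ys} → Pointwise _≤_ xs ys → maxℚ xs ≤ maxℚ ys
maxℚ-mono []       = ≤-refl
maxℚ-mono (p ∷ ps) = ⊔-mono-≤ p (maxℚ-mono ps)

map-pointwise : ∀ {f g : A → ℚ} → (∀ x → f x ≤ g x) → ∀ xs → Pointwise _≤_ (map f xs) (map g xs)
map-pointwise f≤g []       = []
map-pointwise f≤g (x ∷ xs) = f≤g x ∷ map-pointwise f≤g xs

concatMap-pointwise : ∀ {f g : A → List ℚ} → (∀ x → Pointwise _≤_ (f x) (g x)) →
  ∀ xs → Pointwise _≤_ (concatMap f xs) (concatMap g xs)
concatMap-pointwise f≤g []       = []
concatMap-pointwise f≤g (x ∷ xs) = Pointwise.++⁺ (f≤g x) (concatMap-pointwise f≤g xs)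

module _ {Φ Ψ : JoinTree → ℚ} (Φ≤Ψ : ∀ A → Φ A ≤ Ψ A) where

  dagger-mono : ∀ A → Pointwise _≤_ (daggerRHS Φ A) (daggerRHS Ψ A)
  dagger-mono (leaf _)   = []
  dagger-mono (node B C) = concatMap-pointwise
    (λ (X , Y) → map-pointwise
      (λ D → +-monoˡ-≤ (ΔA (node B C ⊖ (V Y ++ V D))) (+-monoˡ-≤ (ΔA (Y ⊖ V D)) (Φ≤Ψ D))) (⪯list X))
    ((B , C) ∷ (C , B) ∷ [])

  ddagger-mono : ∀ A → Pointwise _≤_ (ddaggerRHS Φ A) (ddaggerRHS Ψ A)
  ddagger-mono A = concatMap-pointwise (λ D → map-pointwise
    (λ E → *-monoˡ-≤-nonNeg ½ (+-monoˡ-≤ (ΔA (A ⊖ (V D ++ V E)))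
      (+-monoˡ-≤ (ΔA A) (+-mono-≤ (Φ≤Ψ D) (Φ≤Ψ (E ⊖ V D)))))) (≺list A)) (≺list A)

rhs : (JoinTree → ℚ) → JoinTree → List ℚ
rhs Φ A = daggerRHS Φ A ++ ddaggerRHS Φ A

-- All right-hand sides are monotone in Φ, and with no fuel the value 0 is the least possible.
Φfuel-mono : ∀ {m n} → m ℕ.≤ n → ∀ A → Φfuel m A ≤ Φfuel n A
Φfuel-mono {n = zero}      z≤n       A = ≤-refl
Φfuel-mono {n = suc n}     z≤n       A = p≤p⊔q 0ℚ (maxℚ (rhs (Φfuel n) A))
Φfuel-mono {suc m} {suc n} (s≤s m≤n) A =
  ⊔-mono-≤ {x = 0ℚ} {y = 0ℚ} {u = maxℚ (rhs (Φfuel n) A)} {v = maxℚ (rhs (Φfuel m) A)} ≤-refl (maxℚ-mono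
    (Pointwise.++⁺ (dagger-mono (Φfuel-mono m≤n) A) (ddagger-mono (Φfuel-mono m≤n) A)))

≺-size : ∀ {D A} → D ≺ A → size D ℕ.< size A
≼-size : ∀ {D A} → D ≼ A → size D ℕ.≤ size A
≺-size (left  D≼B) = s≤s (ℕ.≤-trans (≼-size D≼B) (ℕ.m≤m+n _ _))
≺-size (right D≼C) = s≤s (ℕ.≤-trans (≼-size D≼C) (ℕ.m≤n+m _ _))
≼-size (inj₁ refl) = ℕ.≤-refl
≼-size (inj₂ D≺A)  = ℕ.<⇒≤ (≺-size D≺A)

⊖-size : ∀ A S → size (A ⊖ S) ℕ.≤ size A
⊖-size A S = relabel-size A
  where
  relabel-size : ∀ B → size (relabel (graph A) S B) ℕ.≤ size B
  relabel-size (leaf nothing)  = z≤n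
  relabel-size (leaf (just e)) with keptᵇ (graph A) S e
  ... | true  = ℕ.≤-refl
  ... | false = z≤n
  relabel-size (node B C) = s≤s (ℕ.+-mono-≤ (relabel-size B) (relabel-size C))

∈⪯list : ∀ {D A} → D ≼ A → D ∈ ⪯list A
∈⪯list {A = leaf _}   (inj₁ refl)        = there (here refl)
∈⪯list {A = node _ _} (inj₁ refl)        = there (here refl)
∈⪯list {A = node B C} (inj₂ (left D≼B))  = there (there (∈-++⁺ˡ (∈⪯list D≼B)))
∈⪯list {A = node B C} (inj₂ (right D≼C)) = there (there (∈-++⁺ʳ (⪯list B) (∈⪯list D≼C)))

eqJT-size : ∀ A B → T (eqJT A B) → size A ≡ size B
eqJT-size (leaf nothing)  (leaf nothing)  _ = refl
eqJT-size (leaf (just _)) (leaf (just _)) _ = refl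
eqJT-size (node A B) (node C D) eq with Equivalence.to (T-∧ {eqJT A C}) eq
... | eqˡ , eqʳ = cong suc (cong₂ ℕ._+_ (eqJT-size A C eqˡ) (eqJT-size B D eqʳ))

-- `≺list` discards trees by `eqJT`, which preserves `size`.
smaller∈≺list : ∀ {D A} → D ∈ ⪯list A → size D ℕ.< size A → D ∈ ≺list A
smaller∈≺list {D} {A} D∈ size< = ∈-filter⁺ (λ D → T? (not (eqJT D A))) D∈ different
  where
  different : T (not (eqJT D A))
  different with eqJT D A in eq
  ... | true  = ⊥-elim (ℕ.<⇒≢ size< (eqJT-size D A (subst T (sym eq) _)))
  ... | false = _

⟦⟧∈≺list : ∀ A → 0 ℕ.< size A → ⟦⟧ ∈ ≺list A
⟦⟧∈≺list A@(leaf _)   = smaller∈≺list {⟦⟧} {A} (here refl)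
⟦⟧∈≺list A@(node _ _) = smaller∈≺list {⟦⟧} {A} (here refl)

-- The recursive calls in Φθ A are made with fuel size A − 1, which is at least the size of their arguments.
Φθ≤Φfuel : ∀ {n D} → size D ℕ.≤ n → Φθ D ≤ Φfuel n D
Φθ≤Φfuel {D = D} size≤ = Φfuel-mono size≤ D

-- (†) with its Δ-terms dropped, as they are nonnegative by `Δ≥0`.
dagger : ∀ {D A} → D ≺ A → Φθ D ≤ Φθ A
dagger {D} {A@(node B C)} D≺A = ≤-trans (Φθ≤Φfuel {D = D} (s≤s⁻¹ (≺-size D≺A)))
  (≤-trans (in-list D≺A) (p≤q⊔p 0ℚ (maxℚ (rhs Φ A))))
  where
  Φ = Φfuel (size B ℕ.+ size C)
  term : JoinTree → JoinTree → ℚ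
  term Y D = Φ D + ΔA (Y ⊖ V D) + ΔA (A ⊖ (V Y ++ V D))
  ≤+Δ : ∀ x F → x ≤ x + Δθ F
  ≤+Δ x F = subst (_≤ x + Δθ F) (+-identityʳ x) (+-monoʳ-≤ x (Δ≥0 F))
  Φ≤term : ∀ Y → Φ D ≤ term Y D
  Φ≤term Y = ≤-trans (≤+Δ (Φ D) (graph (Y ⊖ V D))) (≤+Δ (Φ D + ΔA (Y ⊖ V D)) (graph (A ⊖ (V Y ++ V D))))
  in-list : D ≺ A → Φ D ≤ maxℚ (rhs Φ A)
  in-list (left D≼B) = ≤-trans (Φ≤term C) (∈⇒≤maxℚ
    (∈-++⁺ˡ (∈-++⁺ˡ (∈-map⁺ (term C) (∈⪯list D≼B)))))
  in-list (right D≼C) = ≤-trans (Φ≤term B) (∈⇒≤maxℚ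
    (∈-++⁺ˡ (∈-++⁺ʳ (map (term C) (⪯list B)) (∈-++⁺ˡ (∈-map⁺ (term B) (∈⪯list D≼C))))))

ddagger : ∀ {D E A} → D ∈ ≺list A → E ∈ ≺list A → size D ℕ.< size A → size E ℕ.< size A →
  ½ * (Φθ D + Φθ (E ⊖ V D) + ΔA A + ΔA (A ⊖ (V D ++ V E))) ≤ Φθ A
-- Replacing `size A` by a variable `n` exposes the successor on which `Φfuel` unfolds.
ddagger {D} {E} {A} D∈ E∈ D< E< = at-fuel (size A) D< E<
  where
  term : (JoinTree → ℚ) → JoinTree → JoinTree → ℚ
  term Φ D E = ½ * (Φ D + Φ (E ⊖ V D) + ΔA A + ΔA (A ⊖ (V D ++ V E)))
  at-fuel : ∀ n → size D ℕ.< n → size E ℕ.< n → term Φθ D E ≤ Φfuel n A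
  at-fuel (suc n) (s≤s D≤) (s≤s E≤) = ≤-trans
    (*-monoˡ-≤-nonNeg ½ (+-monoˡ-≤ (ΔA (A ⊖ (V D ++ V E))) (+-monoˡ-≤ (ΔA A) (+-mono-≤ (Φθ≤Φfuel {D = D} D≤)
      (Φθ≤Φfuel {D = E ⊖ V D} (ℕ.≤-trans (⊖-size E (V D)) E≤))))))
    (≤-trans (∈⇒≤maxℚ (∈-++⁺ʳ (daggerRHS (Φfuel n) A)
      (∈-concatMap⁺ (λ D → map (term (Φfuel n) D) (≺list A)) (lose D∈ (∈-map⁺ (term (Φfuel n) D) E∈)))))
      (p≤q⊔p 0ℚ (maxℚ (rhs (Φfuel n) A))))

⊖-[] : ∀ A → graph (A ⊖ []) ≡ graph A
⊖-[] A = trans (graph-⊖ A []) (filter-all (λ e → T? (keptᵇ (graph A) [] e))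
  (All.tabulate λ {e} _ → all⁻ _ (All.tabulate {xs = componentOf (graph A) e} _)))

-- (‡) with `D` and `E` both `⟦⟧`: their Φ-values are 0 and nothing is removed from `A`, which
-- leaves half of `ΔA A + ΔA A`.
ΔA≤Φ : ∀ A → 0 ℕ.< size A → ΔA A ≤ Φθ A
ΔA≤Φ A 0<size = ≤-trans (≤-reflexive (sym halves)) (ddagger {⟦⟧} {⟦⟧} {A} ⟦⟧∈ ⟦⟧∈ 0<size 0<size)
  where
  ⟦⟧∈ = ⟦⟧∈≺list A 0<size
  halve : ∀ x → ½ * (x + x) ≡ x
  halve x = trans (*-distribˡ-+ ½ x x) (trans (sym (*-distribʳ-+ x ½ ½)) (*-identityˡ x))
  halves : ½ * (0ℚ + 0ℚ + ΔA A + ΔA (A ⊖ [])) ≡ ΔA A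
  halves = trans (cong₂ (λ x y → ½ * (x + y)) (+-identityˡ (ΔA A)) (cong Δθ (⊖-[] A))) (halve (ΔA A))

-- Induction on the size of the join-tree.

induction-step : ∀ A → 0 ℕ.< size A →
  (∀ D → size D ℕ.< size A → thirtieths (λ′ D ℕ.+ 4 ℕ.* ∂′ D) ≤ Φθ D) →
  thirtieths (λ′ A ℕ.+ 4 ℕ.* ∂′ A) ≤ Φθ A
induction-step A 0<size ih = decidable-stable (_ ≤? _) λ ¬bound →
  let
    -- If the bound fails at `A`, every lower bound for `Φθ A` in thirtieths lies strictly below the
    -- target.
    below-target : ∀ n → thirtieths n ≤ Φθ A → n ℕ.< target
    below-target n n≤Φ = ℕ.≰⇒> λ target≤n → ¬bound (≤-trans (thirtieths-mono target≤n) n≤Φ)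
  in no-counterexample A (λ′ A) (∂′ A) refl refl
    (below-target _ (subst (_≤ Φθ A) (Δ-thirtieths (graph A)) (ΔA≤Φ A 0<size)))
    (λ {D} D≺A → below-target _ (≤-trans (ih D (≺-size D≺A)) (dagger D≺A)))
    (λ {D} {E} D≺A E≺A → ℕ.≰⇒> λ target≤ → ¬bound (≤-trans (half-sum D E
        {λ′ D ℕ.+ 4 ℕ.* ∂′ D} {λ′ (E ⊖ V D) ℕ.+ 4 ℕ.* ∂′ (E ⊖ V D)} target≤
        (ih D (≺-size D≺A)) (ih (E ⊖ V D) (ℕ.≤-<-trans (⊖-size E (V D)) (≺-size E≺A))))
      (ddagger {D} {E} {A} (≺⇒∈≺list D≺A) (≺⇒∈≺list E≺A) (≺-size D≺A) (≺-size E≺A))))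
  where
  target = λ′ A ℕ.+ 4 ℕ.* ∂′ A
  ≺⇒∈≺list : ∀ {D} → D ≺ A → D ∈ ≺list A
  ≺⇒∈≺list D≺A = smaller∈≺list (∈⪯list (inj₂ D≺A)) (≺-size D≺A)
  half-sum : ∀ D E {x y} → 2 ℕ.* target ℕ.≤ x ℕ.+ y ℕ.+ 10 ℕ.* ∂′ A →
    thirtieths x ≤ Φθ D → thirtieths y ≤ Φθ (E ⊖ V D) →
    thirtieths target ≤ ½ * (Φθ D + Φθ (E ⊖ V D) + ΔA A + ΔA (A ⊖ (V D ++ V E)))
  half-sum D E {x} {y} target≤ x≤ y≤ = begin
    thirtieths target                      ≡⟨ sym (½-thirtieths target) ⟩
    ½ * thirtieths (2 ℕ.* target)          ≤⟨ *-monoˡ-≤-nonNeg ½ (thirtieths-mono target≤) ⟩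
    ½ * thirtieths (x ℕ.+ y ℕ.+ 10 ℕ.* ∂′ A)
      ≡⟨ cong (½ *_) (trans (thirtieths-+ (x ℕ.+ y) (10 ℕ.* ∂′ A))
           (cong₂ _+_ (thirtieths-+ x y) (sym (Δ-thirtieths (graph A))))) ⟩
    ½ * (thirtieths x + thirtieths y + ΔA A)
      ≤⟨ *-monoˡ-≤-nonNeg ½ (+-monoˡ-≤ (ΔA A) (+-mono-≤ x≤ y≤)) ⟩
    ½ * (Φθ D + Φθ (E ⊖ V D) + ΔA A)
      ≡⟨ cong (½ *_) (sym (+-identityʳ (Φθ D + Φθ (E ⊖ V D) + ΔA A))) ⟩
    ½ * (Φθ D + Φθ (E ⊖ V D) + ΔA A + 0ℚ)
      ≤⟨ *-monoˡ-≤-nonNeg ½ (+-monoʳ-≤ (Φθ D + Φθ (E ⊖ V D) + ΔA A) (Δ≥0 (graph (A ⊖ (V D ++ V E))))) ⟩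
    ½ * (Φθ D + Φθ (E ⊖ V D) + ΔA A + ΔA (A ⊖ (V D ++ V E))) ∎
    where open ≤-Reasoning

-- The induction is on a bound for the size, because `E ⊖ V D` need not be a subtree of `A`.
lower-bound : ∀ n A → size A ℕ.≤ n → thirtieths (λ′ A ℕ.+ 4 ℕ.* ∂′ A) ≤ Φθ A
-- Both sides are 0 here; all other join-trees have positive size.
lower-bound n       (leaf nothing)      _     = subst (_≤ Φθ ⟦⟧) (bound-thirtieths []) ≤-refl
lower-bound (suc n) A@(leaf (just _))   size≤ =
  induction-step A (s≤s z≤n) λ D D< → lower-bound n D (s≤s⁻¹ (ℕ.≤-trans D< size≤))
lower-bound (suc n) A@(node _ _)        size≤ =
  induction-step A (s≤s z≤n) λ D D< → lower-bound n D (s≤s⁻¹ (ℕ.≤-trans D< size≤))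

theorem3p9 : (A : JoinTree) →
    ((+ 1 / 30) * fromℕ (λG (graph A)) + (+ 2 / 5) * Δθ (graph A)) ≤ Φθ A
theorem3p9 A = subst (_≤ Φθ A) (sym (bound-thirtieths (graph A))) (lower-bound (size A) A ℕ.≤-refl)
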